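{- For every covering pattern $M$ and all positive integers $b,m$, the matrix $A[b,m]$ is $M$-free. Hence for every covering pattern $M$, $\mathrm{Ex}(M,n)\ge n2^{\sqrt{\log n}-O(\log\log n)}$ as $n\to\infty$.
   Context: A pattern is a 0--1 matrix. A 0--1 matrix $A$ contains a pattern $P$ if $A$ can be transformed into $P$ by removing rows and columns from $A$ (keeping the order of the remaining ones) and changing some 1s to 0s; otherwise $A$ is $P$-free. $\mathrm{Ex}(P,n)$ is the maximum number of 1s in an $n\times n$ 0--1 matrix that is $P$-free. $\log$ is the binary logarithm. A pattern is acyclic if the bipartite graph whose vertices are its rows and columns and whose edges correspond to its 1s is a forest. Covering pattern. Let $M\in\{0,1\}^{\alpha\times\beta}$ be an acyclic pattern with rows indexed by $0\le i<\alpha$ and columns by $0\le j<\beta$. $M$ is a covering pattern if there is a distinguished row $k^*$ such that: (1) $M(k^*,0)=M(k^*,\beta-1)=1$. (2) Let $J$ be the set of row indices, excluding $k^*$, of rows with at least two 1s. $J$ contains at most one element $j_0<k^*$; if such an element $j_0$ exists, then some column contains two 1s in rows with indices in $[j_0,k^*]$. For every $j\in J$ with $j>k^*$, some column contains two 1s in rows with indices in $[k^*,j]$. (3) For $l\in J$ let $\mathrm{first}(l)$ and $\mathrm{last}(l)$ be the column indices of the first and last 1s in row $l$. Then the real intervals satisfy $\bigcup_{l\in J}[\mathrm{first}(l),\mathrm{last}(l)]=[0,\beta-1]$. The matrix $A[b,m]$. Let $[m]=\{1,\dots,m\}$. The rows of $A=A[b,m]$ are indexed by pairs $(s,r)\in[m]\times[m]^b$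 and its columns by pairs $(c,i)\in[m]^b\times\{0,1\}^b$, both ordered lexicographically. Its entries are $A((s,r),(c,i))=1$ if $r=c+s\cdot i$ (as integer vectors), and $0$ otherwise. -}

module Defs where

open import Algebra.Definitions.RawSemiring using (_^_)
open import Data.Bool using (Bool; true)
open import Data.Fin using (Fin; zero; suc; toℕ; fromℕ; inject₁)
import Data.Fin as Fin
open import Data.Integer using (ℤ; +_; -[1+_])
open import Data.List using (length; filterᵇ; allFin; cartesianProduct)
open import Data.Nat using (ℕ)
import Data.Nat as ℕ
open import Data.Product using (_×_; _,_; ∃-syntax; uncurry)
open import Data.Product.Relation.Binary.Lex.Strict using (×-Lex)
open import Data.Rational.Unnormalised using (ℚᵘ; _/_; 0ℚᵘ; ½; ↥_; ↧ₙ_)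
import Data.Rational.Unnormalised as ℚ
open import Data.Sum using (_⊎_; inj₁; inj₂)
open import Data.Vec using (Vec; map; zipWith)
open import Data.Vec.Properties using (≡-dec)
open import Data.Vec.Relation.Binary.Lex.Strict using (Lex-<)
open import Function using (_⇔_; Injective)
open import Relation.Binary using (Rel; Monotonic₁)
open import Relation.Binary.PropositionalEquality using (_≡_; _≢_)
open import Relation.Nullary using (¬_; does)
open import Level using (0ℓ)

------------------------------------------------------------------------
-- 0-1 matrices and pattern containment

Matrix : ℕ → ℕ → Set
Matrix m n = Fin m → Fin n → Bool

-- The host matrix may be indexed by any strictly ordered sets of rows R
-- and columns C, so that A[b,m] below keeps its own index sets.
-- Removing rows and columns amounts to choosing order-preserving
-- embeddings of the row and column indices of P.
Contains : {R C : Set} → Rel R 0ℓ → Rel C 0ℓ → (R → C → Bool) →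
           ∀ {α β} → Matrix α β → Set
Contains {R} {C} _<R_ _<C_ A {α} {β} P =
  ∃[ f ] ∃[ g ] Monotonic₁ Fin._<_ _<R_ f × Monotonic₁ Fin._<_ _<C_ g ×
    (∀ (i : Fin α) (j : Fin β) → P i j ≡ true → A (f i) (g j) ≡ true)

Free : ∀ {m n α β} → Matrix α β → Matrix m n → Set
Free P A = ¬ Contains Fin._<_ Fin._<_ A P

ones : ∀ {m n} → Matrix m n → ℕ
ones {m} {n} A =
  length (filterᵇ (uncurry A) (cartesianProduct (allFin m) (allFin n)))

-- e = Ex(P,n).  A relation, because the maximum does not exist when
-- every n × n matrix contains P (e.g. if P has no 1s and n is large).
IsEx : ∀ {α β} → Matrix α β → ℕ → ℕ → Set
IsEx P n e =
  (∃[ A ] Free P A × ones {n} {n} A ≡ e) ×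
  (∀ (A : Matrix n n) → Free P A → ones A ℕ.≤ e)

------------------------------------------------------------------------
-- Acyclic patterns

data Adjacent {α β} (M : Matrix α β) : Rel (Fin α ⊎ Fin β) 0ℓ where
  row-col : ∀ {i j} → M i j ≡ true → Adjacent M (inj₁ i) (inj₂ j)
  col-row : ∀ {i j} → M i j ≡ true → Adjacent M (inj₂ j) (inj₁ i)

record Cycle {V : Set} (_∼_ : Rel V 0ℓ) : Set where
  field
    k        : ℕ
    vertex   : Fin (3 ℕ.+ k) → V
    distinct : Injective _≡_ _≡_ vertex
    step     : ∀ (i : Fin (2 ℕ.+ k)) → vertex (inject₁ i) ∼ vertex (suc i)
    close    : vertex (fromℕ (2 ℕ.+ k)) ∼ vertex zero

Acyclic : ∀ {α β} → Matrix α β → Set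
Acyclic M = ¬ Cycle (Adjacent M)

------------------------------------------------------------------------
-- Covering patterns

module _ {α β} (M : Matrix α β) where

  InJ : Fin α → Fin α → Set
  InJ k l = l ≢ k × (∃[ c ] ∃[ c′ ] c ≢ c′ × M l c ≡ true × M l c′ ≡ true)

  IsFirst IsLast : Fin α → Fin β → Set
  IsFirst l c = M l c ≡ true × (∀ c′ → M l c′ ≡ true → c Fin.≤ c′)
  IsLast  l c = M l c ≡ true × (∀ c′ → M l c′ ≡ true → c′ Fin.≤ c)

  -- Some column has two 1s in rows with indices in [lo,hi].
  TwoInColumn : Fin α → Fin α → Set
  TwoInColumn lo hi = ∃[ c ] ∃[ r ] ∃[ r′ ] r ≢ r′ ×
    (lo Fin.≤ r × r Fin.≤ hi × M r c ≡ true) ×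
    (lo Fin.≤ r′ × r′ Fin.≤ hi × M r′ c ≡ true)

ℕ→ℚ : ℕ → ℚᵘ
ℕ→ℚ n = + n / 1

-- The pattern has suc β columns, so the last column has index β and the
-- interval to be covered is [0,β].  Covering is stated at rational points:
-- a finite union of intervals with integer endpoints equals [0,β] over the
-- reals exactly when the two sets have the same rational points.  For
-- β = 0 the interval is the nonempty set {0}, so J cannot be empty.
record IsCoveringAt {α β} (M : Matrix α (ℕ.suc β)) (k : Fin α) : Set where
  field
    first-one    : M k zero ≡ true
    last-one     : M k (fromℕ β) ≡ true
    above-unique : ∀ {j j′} → InJ M k j → InJ M k j′ →
                   j Fin.< k → j′ Fin.< k → j ≡ j′
    above        : ∀ {j} → InJ M k j → j Fin.< k → TwoInColumn M j k
    below        : ∀ {j} → InJ M k j → k Fin.< j → TwoInColumn M k j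
    covering     : ∀ (x : ℚᵘ) →
      (∃[ l ] ∃[ a ] ∃[ b ] InJ M k l × IsFirst M l a × IsLast M l b ×
         ℕ→ℚ (toℕ a) ℚ.≤ x × x ℚ.≤ ℕ→ℚ (toℕ b))
      ⇔ (0ℚᵘ ℚ.≤ x × x ℚ.≤ ℕ→ℚ β)

IsCovering : ∀ {α β} → Matrix α (ℕ.suc β) → Set
IsCovering M = Acyclic M × (∃[ k ] IsCoveringAt M k)

------------------------------------------------------------------------
-- The matrix A[b,m]

-- [m] = {1,…,m} is represented by Fin m, the element x standing for:
val : ∀ {m} → Fin m → ℕ
val x = ℕ.suc (toℕ x)

module _ (b m : ℕ) where

  Row Col : Set
  Row = Fin m × Vec (Fin m) b
  Col = Vec (Fin m) b × Vec (Fin 2) b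

  _<Row_ : Rel Row 0ℓ
  _<Row_ = ×-Lex _≡_ Fin._<_ (Lex-< _≡_ Fin._<_)

  _<Col_ : Rel Col 0ℓ
  _<Col_ = ×-Lex _≡_ (Lex-< _≡_ Fin._<_) (Lex-< _≡_ Fin._<_)

  A[_,_] : Row → Col → Bool
  A[_,_] (s , r) (c , i) = does (≡-dec ℕ._≟_ (map val r)
    (zipWith ℕ._+_ (map val c) (map (λ t → val s ℕ.* toℕ t) i)))

  A-Free : ∀ {α β} → Matrix α β → Set
  A-Free P = ¬ Contains _<Row_ _<Col_ A[_,_] P

------------------------------------------------------------------------
-- Real numbers

-- A real x is given by its Dedekind cut: lower x q means q < x, and
-- upper x q means x < q.  The laws of cuts are not recorded; each
-- operation below produces the cut of the intended real number when its
-- arguments are cuts of reals in the domain of the operation.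
record ℝ : Set₁ where
  field
    lower upper : ℚᵘ → Set

open ℝ public

infix 4 _≤ᴿ_
_≤ᴿ_ : ℝ → ℝ → Set
x ≤ᴿ y = ∀ q → lower x q → lower y q

fromNat : ℕ → ℝ
fromNat n .lower q = q ℚ.< ℕ→ℚ n
fromNat n .upper q = ℕ→ℚ n ℚ.< q

infixl 7 _·_
_·_ : ℕ → ℝ → ℝ
(n · x) .lower q = ∃[ r ] lower x r × q ℚ.< ℕ→ℚ n ℚ.* r
(n · x) .upper q = ∃[ r ] upper x r × ℕ→ℚ n ℚ.* r ℚ.< q

infixl 6 _-_
_-_ : ℝ → ℝ → ℝ
(x - y) .lower q = ∃[ r ] ∃[ s ] lower x r × upper y s × q ℚ.< r ℚ.- s
(x - y) .upper q = ∃[ r ] ∃[ s ] upper x r × lower y s × r ℚ.- s ℚ.< q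

-- The square root of a nonnegative real.
√ : ℝ → ℝ
√ x .lower q = q ℚ.< 0ℚᵘ ⊎ lower x (q ℚ.* q)
√ x .upper q = 0ℚᵘ ℚ.< q × upper x (q ℚ.* q)

infixr 8 _^ℚ_
_^ℚ_ : ℚᵘ → ℕ → ℚᵘ
_^ℚ_ = _^_ ℚ.+-*-rawSemiring

2^ℤ_ : ℤ → ℚᵘ
2^ℤ (+ n)    = ℕ→ℚ 2 ^ℚ n
2^ℤ -[1+ n ] = ½ ^ℚ ℕ.suc n

-- q < 2^(a/d) and 2^(a/d) < q for rational q and a/d, decided by
-- comparing d-th powers.
_<2^_ _>2^_ : ℚᵘ → ℚᵘ → Set
q <2^ r = q ℚ.< 0ℚᵘ ⊎ q ^ℚ ↧ₙ r ℚ.< 2^ℤ (↥ r)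
q >2^ r = 0ℚᵘ ℚ.< q × 2^ℤ (↥ r) ℚ.< q ^ℚ ↧ₙ r

2^_ : ℝ → ℝ
(2^ x) .lower q = ∃[ r ] lower x r × q <2^ r
(2^ x) .upper q = ∃[ r ] upper x r × q >2^ r

-- The binary logarithm of a positive real.
log₂ : ℝ → ℝ
log₂ x .lower q = ∃[ r ] lower x r × r >2^ q
log₂ x .upper q = ∃[ r ] upper x r × r <2^ q

{-# OPTIONS --safe #-}

-- If M embeds into A[b,m], look at the first coordinate p in which the vectors c
-- of the first and last columns differ.  Along the columns c_p is weakly
-- increasing and rises in total by s(k*).  A row l of J with l > k* has
-- s(l) > s(k*), so c_p is constant on its interval; the only row of J before k*
-- has s < s(k*) and allows a rise of at most s.  As the intervals of J cover all
-- columns, the total rise is less than s(k*), a contradiction.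
--
-- For the bound on Ex(M,n), choose b with 2^(b(b+1)) ≤ n < 2^((b+1)(b+2)), the
-- largest m with m^(b+1) ≤ n, and t = ⌊m/b⌋.  Then A[b,m] fits into an n × n
-- matrix and the rows with s ≤ t alone give t(2m-t)^b ≥ 2^b n / (8b) ones, where
-- √(log n) < b+2 and log log n > 2 log b.

module Submission where

open import Defs
open import Data.Bool using (Bool; true; false; _∧_)
import Data.Bool as Bool
open import Data.Bool.Properties using (T-≡; T?)
open import Data.Empty using (⊥)
open import Data.Fin using (Fin; zero; suc; toℕ; fromℕ; inject₁; fromℕ<; inject≤; combine; remQuot; splitAt; join)
import Data.Fin as Fin
import Data.Fin.Properties as Fin
open import Data.Fin.Induction using (<-weakInduction)
open import Data.Integer using (ℤ; -[1+_])
import Data.Integer as ℤ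
import Data.Integer.Properties as ℤ
import Data.Integer.Tactic.RingSolver as ℤ-Solver
open import Data.List using (length; filterᵇ; allFin; cartesianProduct)
import Data.List as List
open import Data.List.Properties using (length-filter)
open import Data.List.Membership.Propositional using (_∈_)
open import Data.List.Membership.Propositional.Properties using (∈-filter⁺; ∈-cartesianProduct⁺; ∈-allFin)
import Data.List.Membership.Setoid.Properties as Membership
open import Data.List.Relation.Unary.Any using (index)
open import Data.Nat using (ℕ; zero; suc; _+_; _*_; _^_; _∸_; _≤_; _<_; z≤n; s≤s; _≟_; _<?_; _≤?_; _/_; _%_; NonZero; >-nonZero)
open import Data.Nat.DivMod using (m≡m%n+[m/n]*n; m%n<n; m/n*n≤m; m/n≤m; m≥n⇒m/n>0)
open import Data.Nat.Properties
open import Algebra.Properties.CommutativeSemigroup *-commutativeSemigroup using (interchange; xy∙z≈xz∙y)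
open import Data.Nat.Tactic.RingSolver using (solve-∀)
open import Data.Product using (_×_; _,_; ∃; ∃-syntax; proj₁; proj₂; uncurry)
open import Data.Rational.Unnormalised using (mkℚᵘ; *≤*; *<*; 0ℚᵘ)
import Data.Rational.Unnormalised as ℚ
import Data.Rational.Unnormalised.Properties as ℚ
open import Data.Sum using (_⊎_; inj₁; inj₂)
open import Data.Unit using (tt)
open import Data.Vec using (Vec; []; _∷_; map; zipWith; lookup; head; tail; tabulate)
open import Data.Vec.Properties using (≡-dec; lookup-map; lookup-zipWith; lookup∘tabulate; tabulate∘lookup; tabulate-cong)
open import Data.Vec.Relation.Binary.Lex.Strict using (Lex-<; Lex-≤; base; this; next)
open import Function using (_∘_; Injective)
open import Function.Bundles using (Equivalence)
open import Level using (0ℓ)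
open import Relation.Binary using (Rel; Monotonic₁; tri<; tri≈; tri>)
open import Relation.Binary.PropositionalEquality
open import Relation.Nullary using (Dec; yes; no; contradiction; does)
open import Relation.Nullary.Decidable using (map′; _×-dec_; _→-dec_; ¬?; dec-true)

lookup-injective : ∀ {A : Set} {n} (xs ys : Vec A n) →
                   (∀ p → lookup xs p ≡ lookup ys p) → xs ≡ ys
lookup-injective xs ys eq =
  trans (sym (tabulate∘lookup xs)) (trans (tabulate-cong eq) (tabulate∘lookup ys))

-- Weakly increasing sequences of vectors in the lexicographic order

infix 4 _≤ᴸ_ _<ᴸ_
_≤ᴸ_ _<ᴸ_ : ∀ {m b} → Vec (Fin m) b → Vec (Fin m) b → Set
_≤ᴸ_ = Lex-≤ _≡_ Fin._<_
_<ᴸ_ = Lex-< _≡_ Fin._<_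

<ᴸ⇒≤ᴸ : ∀ {m b} {xs ys : Vec (Fin m) b} → xs <ᴸ ys → xs ≤ᴸ ys
<ᴸ⇒≤ᴸ (this x<y eq) = this x<y eq
<ᴸ⇒≤ᴸ (next x≡y lt) = next x≡y (<ᴸ⇒≤ᴸ lt)

≤ᴸ-refl : ∀ {m b} (xs : Vec (Fin m) b) → xs ≤ᴸ xs
≤ᴸ-refl []       = base tt
≤ᴸ-refl (x ∷ xs) = next refl (≤ᴸ-refl xs)

<ᴸ-irrefl : ∀ {m b} (xs : Vec (Fin m) b) → xs <ᴸ xs → ⊥
<ᴸ-irrefl (x ∷ xs) (this x<x _) = Fin.<-irrefl refl x<x
<ᴸ-irrefl (x ∷ xs) (next _ lt)  = <ᴸ-irrefl xs lt

head-mono : ∀ {m b} {xs ys : Vec (Fin m) (suc b)} → xs ≤ᴸ ys → head xs Fin.≤ head ys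
head-mono (this x<y _) = <⇒≤ x<y
head-mono (next x≡y _) = Fin.≤-reflexive x≡y

tail-mono : ∀ {m b} {xs ys : Vec (Fin m) (suc b)} →
            head xs ≡ head ys → xs ≤ᴸ ys → tail xs ≤ᴸ tail ys
tail-mono x≡y (this x<y _) = contradiction x<y (Fin.<-irrefl x≡y)
tail-mono x≡y (next _ le)  = le

lookup-zero : ∀ {A : Set} {n} (xs : Vec A (suc n)) → lookup xs zero ≡ head xs
lookup-zero (x ∷ xs) = refl

lookup-suc : ∀ {A : Set} {n} (xs : Vec A (suc n)) p → lookup xs (suc p) ≡ lookup (tail xs) p
lookup-suc (x ∷ xs) p = refl

head-tail-≡ : ∀ {A : Set} {n} (xs ys : Vec A (suc n)) →
              head xs ≡ head ys → tail xs ≡ tail ys → xs ≡ ys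
head-tail-≡ (x ∷ xs) (y ∷ ys) refl refl = refl

Pivot : ∀ {m b n} → (Fin (suc n) → Vec (Fin m) b) → Fin b → Set
Pivot {n = n} c p = (∀ {i j} → i Fin.≤ j → lookup (c i) p Fin.≤ lookup (c j) p) ×
                    lookup (c zero) p Fin.< lookup (c (fromℕ n)) p

-- If the heads at both ends agree, every head is squeezed between them, so the tails are again
-- lexicographically increasing and induction on `b` continues. The first position where the ends
-- differ is the pivot.
constant-or-pivot : ∀ {m n} b (c : Fin (suc n) → Vec (Fin m) b) →
                    (∀ {i j} → i Fin.≤ j → c i ≤ᴸ c j) →
                    c zero ≡ c (fromℕ n) ⊎ ∃[ p ] Pivot c p
constant-or-pivot 0 c mono with [] ← c zero | [] ← c (fromℕ _) = inj₁ refl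
constant-or-pivot {n = n} (suc b) c mono
  with head (c zero) Fin.<? head (c (fromℕ n))
... | yes lt = inj₂ (zero ,
        (λ {i} {j} i≤j → subst₂ Fin._≤_ (sym (lookup-zero (c i))) (sym (lookup-zero (c j)))
                           (head-mono (mono i≤j))) ,
        subst₂ Fin._<_ (sym (lookup-zero (c zero))) (sym (lookup-zero (c (fromℕ n)))) lt)
... | no ≮ = step (constant-or-pivot b (tail ∘ c) (λ {i} {j} i≤j →
                tail-mono (trans (sym (heads i)) (heads j)) (mono i≤j)))
  where
  heads : ∀ i → head (c zero) ≡ head (c i)
  heads i = Fin.≤-antisym (head-mono (mono z≤n))
    (Fin.≤-trans (head-mono (mono (Fin.≤fromℕ i))) (≮⇒≥ ≮))
  step : tail (c zero) ≡ tail (c (fromℕ n)) ⊎ ∃[ p ] Pivot (tail ∘ c) p →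
         c zero ≡ c (fromℕ n) ⊎ ∃[ p ] Pivot c p
  step (inj₁ eq) = inj₁ (head-tail-≡ _ _ (heads (fromℕ n)) eq)
  step (inj₂ (p , le , lt)) = inj₂ (suc p ,
    (λ {i} {j} i≤j → subst₂ Fin._≤_ (sym (lookup-suc (c i) p)) (sym (lookup-suc (c j) p)) (le i≤j)) ,
    subst₂ Fin._<_ (sym (lookup-suc (c zero) p)) (sym (lookup-suc (c (fromℕ n)) p)) lt)

-- Fractions with nonnegative numerators

frac-≤⁺ : ∀ {a c d e} → a * suc e ≤ c * suc d → mkℚᵘ (ℤ.+ a) d ℚ.≤ mkℚᵘ (ℤ.+ c) e
frac-≤⁺ {a} {c} {d} {e} le =
  *≤* (subst₂ ℤ._≤_ (ℤ.pos-* a (suc e)) (ℤ.pos-* c (suc d)) (ℤ.+≤+ le))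

frac-≤⁻ : ∀ {a c d e} → mkℚᵘ (ℤ.+ a) d ℚ.≤ mkℚᵘ (ℤ.+ c) e → a * suc e ≤ c * suc d
frac-≤⁻ {a} {c} {d} {e} (*≤* le) =
  ℤ.drop‿+≤+ (subst₂ ℤ._≤_ (sym (ℤ.pos-* a (suc e))) (sym (ℤ.pos-* c (suc d))) le)

frac-<⁺ : ∀ {a c d e} → a * suc e < c * suc d → mkℚᵘ (ℤ.+ a) d ℚ.< mkℚᵘ (ℤ.+ c) e
frac-<⁺ {a} {c} {d} {e} lt =
  *<* (subst₂ ℤ._<_ (ℤ.pos-* a (suc e)) (ℤ.pos-* c (suc d)) (ℤ.+<+ lt))

frac-<⁻ : ∀ {a c d e} → mkℚᵘ (ℤ.+ a) d ℚ.< mkℚᵘ (ℤ.+ c) e → a * suc e < c * suc d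
frac-<⁻ {a} {c} {d} {e} (*<* lt) =
  ℤ.drop‿+<+ (subst₂ ℤ._<_ (sym (ℤ.pos-* a (suc e))) (sym (ℤ.pos-* c (suc d))) lt)

-- Entries of `A[b,m]`, coordinate by coordinate.

A⁻ : ∀ {b m} (s : Fin m) (r c : Vec (Fin m) b) i →
     A[_,_] b m (s , r) (c , i) ≡ true →
     ∀ p → val (lookup r p) ≡ val (lookup c p) + val s * toℕ (lookup i p)
A⁻ s r c i eq p with ≡-dec _≟_ (map val r)
    (zipWith _+_ (map val c) (map (λ t → val s * toℕ t) i))
... | no _    = contradiction eq λ ()
... | yes r≡ = begin
  val (lookup r p)
    ≡⟨ lookup-map p val r ⟨
  lookup (map val r) p
    ≡⟨ cong (λ v → lookup v p) r≡ ⟩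
  lookup (zipWith _+_ (map val c) (map (λ t → val s * toℕ t) i)) p
    ≡⟨ lookup-zipWith _+_ p (map val c) (map (λ t → val s * toℕ t) i) ⟩
  lookup (map val c) p + lookup (map (λ t → val s * toℕ t) i) p
    ≡⟨ cong₂ _+_ (lookup-map p val c) (lookup-map p _ i) ⟩
  val (lookup c p) + val s * toℕ (lookup i p) ∎
  where open ≡-Reasoning

A⁺ : ∀ {b m} (s : Fin m) (r c : Vec (Fin m) b) i →
     (∀ p → val (lookup r p) ≡ val (lookup c p) + val s * toℕ (lookup i p)) →
     A[_,_] b m (s , r) (c , i) ≡ true
A⁺ s r c i eq with ≡-dec _≟_ (map val r)
    (zipWith _+_ (map val c) (map (λ t → val s * toℕ t) i))
... | yes _  = refl
... | no r≢ = contradiction (lookup-injective _ _ (λ p → begin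
  lookup (map val r) p
    ≡⟨ lookup-map p val r ⟩
  val (lookup r p)
    ≡⟨ eq p ⟩
  val (lookup c p) + val s * toℕ (lookup i p)
    ≡⟨ cong₂ _+_ (lookup-map p val c) (lookup-map p _ i) ⟨
  lookup (map val c) p + lookup (map (λ t → val s * toℕ t) i) p
    ≡⟨ lookup-zipWith _+_ p (map val c) (map (λ t → val s * toℕ t) i) ⟨
  lookup (zipWith _+_ (map val c) (map (λ t → val s * toℕ t) i)) p ∎)) r≢
  where open ≡-Reasoning

-- Two ones of one row share the value of `r` at each coordinate, so the two values of `c` there
-- differ by `S` times a difference of bits. A difference of the wrong sign would be a fall, which
-- `x ≤ y` leaves possible only as equality.
step-zero-or-full : ∀ {x y} S (e e′ : Fin 2) → x + S * toℕ e ≡ y + S * toℕ e′ → x ≤ y →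
                    y ≡ x ⊎ y ≡ x + S
step-zero-or-full S zero zero eq x≤y = inj₁ (sym (+-cancelʳ-≡ (S * 0) _ _ eq))
step-zero-or-full S (suc zero) (suc zero) eq x≤y = inj₁ (sym (+-cancelʳ-≡ (S * 1) _ _ eq))
step-zero-or-full {x} {y} S (suc zero) zero eq x≤y = inj₂ (begin
  y         ≡⟨ +-identityʳ y ⟨
  y + 0     ≡⟨ cong (y +_) (*-zeroʳ S) ⟨
  y + S * 0 ≡⟨ eq ⟨
  x + S * 1 ≡⟨ cong (x +_) (*-identityʳ S) ⟩
  x + S     ∎)
  where open ≡-Reasoning
step-zero-or-full {x} {y} S zero (suc zero) eq x≤y = inj₁ (≤-antisym (begin
  y         ≤⟨ m≤m+n y _ ⟩
  y + S * 1 ≡⟨ eq ⟨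
  x + S * 0 ≡⟨ cong (x +_) (*-zeroʳ S) ⟩
  x + 0     ≡⟨ +-identityʳ x ⟩
  x         ∎) x≤y)
  where open ≤-Reasoning

-- Covering patterns do not embed, even if empty rows may be put anywhere

Nonempty : ∀ {α β} → Matrix α β → Fin α → Set
Nonempty M i = ∃[ j ] M i j ≡ true

module NoEmbedding
  {α β} (M : Matrix α (suc β)) (k : Fin α) (cov : IsCoveringAt M k)
  (b m : ℕ) (f : Fin α → Row b m) (g : Fin (suc β) → Col b m)
  -- In the finite-matrix application, rows outside the corner are all sent to one default value.
  -- Such rows are empty, so order is demanded between nonempty rows only.
  (f-mono : ∀ {i i′} → Nonempty M i → Nonempty M i′ → i Fin.< i′ → _<Row_ b m (f i) (f i′))
  (g-mono : Monotonic₁ Fin._<_ (_<Col_ b m) g)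
  (entry : ∀ i j → M i j ≡ true → A[_,_] b m (f i) (g j) ≡ true)
  where

  open IsCoveringAt cov

  S : Fin α → ℕ
  S i = val (proj₁ (f i))

  c : Fin (suc β) → Vec (Fin m) b
  c j = proj₁ (g j)

  e : Fin (suc β) → Vec (Fin 2) b
  e j = proj₂ (g j)

  entry-at : ∀ {i j} → M i j ≡ true → ∀ p →
             val (lookup (proj₂ (f i)) p) ≡ val (lookup (c j) p) + S i * toℕ (lookup (e j) p)
  entry-at {i} {j} Mij = A⁻ (proj₁ (f i)) (proj₂ (f i)) (c j) (e j) (entry i j Mij)

  InJ⇒Nonempty : ∀ {l} → InJ M k l → Nonempty M l
  InJ⇒Nonempty (_ , c , _ , _ , Mlc , _) = c , Mlc

  k-nonempty : Nonempty M k
  k-nonempty = zero , first-one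

  c-mono : ∀ {i j} → i Fin.≤ j → c i ≤ᴸ c j
  c-mono {i} {j} i≤j with m≤n⇒m<n∨m≡n i≤j
  ... | inj₂ eq rewrite Fin.toℕ-injective eq = ≤ᴸ-refl (c j)
  ... | inj₁ i<j with g-mono i<j
  ...   | inj₁ lt = <ᴸ⇒≤ᴸ lt
  ...   | inj₂ (eq , _) = subst (c i ≤ᴸ_) eq (≤ᴸ-refl (c i))

  S-mono : ∀ {i i′} → Nonempty M i → Nonempty M i′ → i Fin.≤ i′ → S i ≤ S i′
  S-mono ne ne′ i≤i′ with m≤n⇒m<n∨m≡n i≤i′
  ... | inj₂ eq rewrite Fin.toℕ-injective eq = ≤-refl
  ... | inj₁ i<i′ with f-mono ne ne′ i<i′
  ...   | inj₁ lt = s≤s (<⇒≤ lt)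
  ...   | inj₂ (eq , _) = ≤-reflexive (cong val eq)

  -- Two ones in one column determine r from (c , i) and s, so they cannot
  -- share s.
  S-distinct-< : ∀ {r r′ j} → r Fin.< r′ → M r j ≡ true → M r′ j ≡ true → S r ≢ S r′
  S-distinct-< {r} {r′} {j} r<r′ Mr Mr′ Seq with f-mono (j , Mr) (j , Mr′) r<r′
  ... | inj₁ lt = <⇒≢ lt (suc-injective Seq)
  ... | inj₂ (_ , lt) = <ᴸ-irrefl _ (subst (_<ᴸ proj₂ (f r′)) r≡r′ lt)
    where
    r≡r′ : proj₂ (f r) ≡ proj₂ (f r′)
    r≡r′ = lookup-injective _ _ λ p → Fin.toℕ-injective (suc-injective (trans (entry-at Mr p)
      (trans (cong (λ s → val (lookup (c j) p) + s * toℕ (lookup (e j) p)) Seq)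
             (sym (entry-at Mr′ p)))))

  S-distinct : ∀ {r r′ j} → r ≢ r′ → M r j ≡ true → M r′ j ≡ true → S r ≢ S r′
  S-distinct {r} {r′} r≢r′ Mr Mr′ with Fin.<-cmp r r′
  ... | tri< lt _ _ = S-distinct-< lt Mr Mr′
  ... | tri≈ _ eq _ = contradiction eq r≢r′
  ... | tri> _ _ gt = S-distinct-< gt Mr′ Mr ∘ sym

  -- If `S lo` and `S hi` were equal, monotonicity would force both ones of the common column to lie
  -- in rows with the same `S`, against `S-distinct`.
  S-strict : ∀ {lo hi} → Nonempty M lo → Nonempty M hi → lo Fin.≤ hi →
             TwoInColumn M lo hi → S lo < S hi
  S-strict {lo} {hi} nlo nhi lo≤hi (j , r , r′ , r≢r′ , (lo≤r , r≤hi , Mr) , (lo≤r′ , r′≤hi , Mr′)) =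
    ≤∧≢⇒< (S-mono nlo nhi lo≤hi) λ Seq → S-distinct r≢r′ Mr Mr′
      (trans (pinch Seq (j , Mr) lo≤r r≤hi) (sym (pinch Seq (j , Mr′) lo≤r′ r′≤hi)))
    where
    pinch : S lo ≡ S hi → ∀ {x} → Nonempty M x → lo Fin.≤ x → x Fin.≤ hi → S x ≡ S lo
    pinch Seq nx lo≤x x≤hi = ≤-antisym
      (≤-trans (S-mono nx nhi x≤hi) (≤-reflexive (sym Seq))) (S-mono nlo nx lo≤x)

  -- Interval endpoints are integers, so an interval that contains `j + 1/2` contains both `j` and
  -- `j + 1`. Covering the half-integers is thus enough to link each pair of neighbouring columns.
  covering-step : ∀ (j : Fin β) → ∃[ l ] ∃[ a ] ∃[ z ] InJ M k l × IsFirst M l a × IsLast M l z ×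
                  toℕ a ≤ toℕ j × toℕ j < toℕ z
  covering-step j = extract (Equivalence.from (covering midpoint) (frac-≤⁺ z≤n , frac-≤⁺ (begin
    (1 + 2 * toℕ j) * 1 ≡⟨ *-identityʳ (1 + 2 * toℕ j) ⟩
    1 + 2 * toℕ j       ≤⟨ n≤1+n _ ⟩
    2 + 2 * toℕ j       ≡⟨ double ⟩
    suc (toℕ j) * 2     ≤⟨ *-monoˡ-≤ 2 (Fin.toℕ<n j) ⟩
    β * 2               ∎)))
    where
    open ≤-Reasoning
    -- This is `j + 1/2`: `mkℚᵘ` takes the denominator minus one.
    midpoint = mkℚᵘ (ℤ.+ (1 + 2 * toℕ j)) 1
    double : 2 + 2 * toℕ j ≡ suc (toℕ j) * 2
    double = cong (2 +_) (*-comm 2 (toℕ j))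
    extract : (∃[ l ] ∃[ a ] ∃[ z ] InJ M k l × IsFirst M l a × IsLast M l z ×
                ℕ→ℚ (toℕ a) ℚ.≤ midpoint × midpoint ℚ.≤ ℕ→ℚ (toℕ z)) →
              ∃[ l ] ∃[ a ] ∃[ z ] InJ M k l × IsFirst M l a × IsLast M l z ×
                toℕ a ≤ toℕ j × toℕ j < toℕ z
    extract (l , a , z , l∈J , first , last , a≤x , x≤z) =
      l , a , z , l∈J , first , last ,
      ≤-pred (*-cancelʳ-< _ (toℕ a) (suc (toℕ j)) (begin-strict
        toℕ a * 2           ≤⟨ frac-≤⁻ a≤x ⟩
        (1 + 2 * toℕ j) * 1 ≡⟨ *-identityʳ (1 + 2 * toℕ j) ⟩
        1 + 2 * toℕ j       <⟨ n<1+n _ ⟩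
        2 + 2 * toℕ j       ≡⟨ double ⟩
        suc (toℕ j) * 2     ∎)) ,
      *-cancelʳ-< _ (toℕ j) (toℕ z) (begin-strict
        toℕ j * 2           ≡⟨ *-comm (toℕ j) 2 ⟩
        2 * toℕ j           <⟨ n<1+n _ ⟩
        1 + 2 * toℕ j       ≡⟨ *-identityʳ (1 + 2 * toℕ j) ⟨
        (1 + 2 * toℕ j) * 1 ≤⟨ frac-≤⁻ x≤z ⟩
        toℕ z * 2           ∎)

  -- Covering at the point 0. It settles patterns with a single column, where no row can have two
  -- distinct ones.
  J-inhabited : ∃[ l ] InJ M k l
  J-inhabited with l , _ , _ , l∈J , _ ← Equivalence.from (covering 0ℚᵘ) (ℚ.≤-refl , frac-≤⁺ z≤n) =
    l , l∈J

  -- The rise of the pivot coordinate along the columns.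

  module _ (p : Fin b) (pivot : Pivot c p) where

    v : Fin (suc β) → ℕ
    v j = toℕ (lookup (c j) p)

    v-mono : ∀ {i j} → i Fin.≤ j → v i ≤ v j
    v-mono = proj₁ pivot

    row-step : ∀ {i a z} → M i a ≡ true → M i z ≡ true → a Fin.≤ z → v z ≡ v a ⊎ v z ≡ v a + S i
    row-step {i} {a} {z} Ma Mz a≤z = step-zero-or-full (S i) (lookup (e a) p) (lookup (e z) p)
      (suc-injective (trans (sym (entry-at Ma p)) (entry-at Mz p))) (v-mono a≤z)

    -- Row `k` has ones in both end columns, so the rise is 0 or `S k`, and the pivot excludes 0.
    total-rise : v (fromℕ β) ≡ v zero + S k
    total-rise with row-step first-one last-one z≤n
    ... | inj₁ eq = contradiction (proj₂ pivot) (<-irrefl (sym eq))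
    ... | inj₂ eq = eq

    -- A full step `S l` would exceed the total rise `S k`, because `S k < S l`.
    flat-below : ∀ {l a z} → InJ M k l → k Fin.< l → M l a ≡ true → M l z ≡ true → a Fin.≤ z →
                 v z ≡ v a
    flat-below {l} {a} {z} l∈J k<l Ma Mz a≤z with row-step Ma Mz a≤z
    ... | inj₁ eq = eq
    ... | inj₂ eq = contradiction (v-mono (Fin.≤fromℕ z)) (<⇒≱ (begin-strict
      v (fromℕ β)  ≡⟨ total-rise ⟩
      v zero + S k <⟨ +-mono-≤-< (v-mono z≤n)
                        (S-strict k-nonempty (InJ⇒Nonempty l∈J) (<⇒≤ k<l) (below l∈J k<l)) ⟩
      v a + S l    ≡⟨ eq ⟨
      v z          ∎))
      where open ≤-Reasoning

    -- The invariant of a walk through the columns: either there is no rise yet, or the interval of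
    -- a row above `k` began at the initial value and every value so far is at most the one at its
    -- last column. Recording that last column lets the row be charged only once, however often its
    -- interval is used.
    Reached : Fin (suc β) → Set
    Reached j = v j ≡ v zero ⊎
      (∃[ l ] ∃[ a ] ∃[ z ] InJ M k l × l Fin.< k × IsFirst M l a × IsLast M l z ×
        v a ≡ v zero × v j ≤ v z)

    -- The interval supplied by `covering-step` contains both columns. If its row lies below `k`,
    -- nothing changes. If it lies above `k`, either the charge for that row begins here or it is
    -- the charge already recorded.
    advance : ∀ j → Reached (inject₁ j) → Reached (suc j)
    advance j reached with covering-step j
    ... | l , a , z , l∈J , (Ma , first) , (Mz , last) , a≤j , j<z = by (Fin.<-cmp l k) reached
      where
      a≤j′ : a Fin.≤ inject₁ j
      a≤j′ = subst (toℕ a ≤_) (sym (Fin.toℕ-inject₁ j)) a≤j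

      by : _ → Reached (inject₁ j) → Reached (suc j)
      by (tri≈ _ l≡k _) _ = contradiction l≡k (proj₁ l∈J)
      by (tri> _ _ k<l) = unchanged
        where
        flat : v (suc j) ≡ v (inject₁ j)
        flat = ≤-antisym
          (≤-trans (v-mono j<z) (≤-trans
            (≤-reflexive (flat-below l∈J k<l Ma Mz (≤-trans a≤j (<⇒≤ j<z)))) (v-mono a≤j′)))
          (v-mono (≤-trans (≤-reflexive (Fin.toℕ-inject₁ j)) (n≤1+n _)))
        unchanged : Reached (inject₁ j) → Reached (suc j)
        unchanged (inj₁ eq) = inj₁ (trans flat eq)
        unchanged (inj₂ (l′ , a′ , z′ , l′∈J , l′<k , first′ , last′ , eq , le)) =
          inj₂ (l′ , a′ , z′ , l′∈J , l′<k , first′ , last′ , eq , ≤-trans (≤-reflexive flat) le)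
      by (tri< l<k _ _) (inj₁ eq) =
        inj₂ (l , a , z , l∈J , l<k , (Ma , first) , (Mz , last) ,
          ≤-antisym (≤-trans (v-mono a≤j′) (≤-reflexive eq)) (v-mono z≤n) , v-mono j<z)
      by (tri< l<k _ _) (inj₂ (l′ , a′ , z′ , l′∈J , l′<k , first′ , (Mz′ , last′) , eq , le))
        -- Both rows above `k` coincide, so `j + 1` is still within the interval already charged.
        with refl ← above-unique l∈J l′∈J l<k l′<k =
          inj₂ (l , a′ , z′ , l′∈J , l′<k , first′ , (Mz′ , last′) , eq ,
            v-mono (≤-trans j<z (last′ z Mz)))

    -- At the last column the invariant allows a rise of at most `S l` for a single row `l` above
    -- `k`, while `total-rise` gives `S k > S l`.
    pivot-⊥ : ⊥
    pivot-⊥ with <-weakInduction Reached (inj₁ refl) advance (fromℕ β)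
    ... | inj₁ eq = <⇒≢ (proj₂ pivot) (sym eq)
    ... | inj₂ (l , a , z , l∈J , l<k , (Ma , first) , (Mz , last) , va≡v0 , le)
      with row-step Ma Mz (first z Mz)
    ... | inj₁ eq = <⇒≱ (proj₂ pivot) (≤-trans le (≤-reflexive (trans eq va≡v0)))
    ... | inj₂ eq = <⇒≱ (begin-strict
      v z          ≡⟨ eq ⟩
      v a + S l    ≡⟨ cong (_+ S l) va≡v0 ⟩
      v zero + S l <⟨ +-monoʳ-< (v zero)
                        (S-strict (InJ⇒Nonempty l∈J) k-nonempty (<⇒≤ l<k) (above l∈J l<k)) ⟩
      v zero + S k ≡⟨ total-rise ⟨
      v (fromℕ β)  ∎) le
      where open ≤-Reasoning

  -- The first and last columns share the row `k`, hence its vector `r`. With `c` equal as well, the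
  -- products of `S k` with the bit vectors agree, and the positive factor `S k` cancels.
  constant⇒equal-columns : c zero ≡ c (fromℕ β) → g zero ≡ g (fromℕ β)
  constant⇒equal-columns eq = cong₂ _,_ eq (lookup-injective _ _ λ p → Fin.toℕ-injective
    (*-cancelˡ-≡ _ _ (S k) (+-cancelˡ-≡ (val (lookup (c zero) p)) _ _ (trans
      (sym (entry-at first-one p)) (trans (entry-at last-one p)
        (cong (λ x → val (lookup x p) + S k * toℕ (lookup (e (fromℕ β)) p)) (sym eq)))))))

<Col-irrefl : ∀ {b m} (x : Col b m) → _<Col_ b m x x → ⊥
<Col-irrefl (c , i) (inj₁ lt) = <ᴸ-irrefl c lt
<Col-irrefl (c , i) (inj₂ (_ , lt)) = <ᴸ-irrefl i lt

no-embedding : ∀ {α β} (M : Matrix α (suc β)) (k : Fin α) → IsCoveringAt M k →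
  ∀ b m (f : Fin α → Row b m) (g : Fin (suc β) → Col b m) →
  (∀ {i i′} → Nonempty M i → Nonempty M i′ → i Fin.< i′ → _<Row_ b m (f i) (f i′)) →
  Monotonic₁ Fin._<_ (_<Col_ b m) g →
  (∀ i j → M i j ≡ true → A[_,_] b m (f i) (g j) ≡ true) → ⊥
no-embedding {β = 0} M k cov b m f g f-mono g-mono entry
  with l , _ , zero , zero , 0≢0 , _ ← NoEmbedding.J-inhabited M k cov b m f g f-mono g-mono entry =
  0≢0 refl
no-embedding {β = suc β} M k cov b m f g f-mono g-mono entry
  with constant-or-pivot b (NoEmbedding.c M k cov b m f g f-mono g-mono entry)
                           (NoEmbedding.c-mono M k cov b m f g f-mono g-mono entry)
-- There are at least two columns in this case, so `g` must separate the first from the last.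
... | inj₁ eq = <Col-irrefl (g zero) (subst (_<Col_ b m (g zero))
  (sym (NoEmbedding.constant⇒equal-columns M k cov b m f g f-mono g-mono entry eq))
  (g-mono {zero} {fromℕ (suc β)} (s≤s z≤n)))
... | inj₂ (p , pivot) = NoEmbedding.pivot-⊥ M k cov b m f g f-mono g-mono entry p pivot

-- Exhaustive search over functions between finite sets, modulo pointwise
-- equality because function extensionality is not available.

Searchable : (A : Set) → Rel A 0ℓ → Set₁
Searchable A _≈_ = ∀ {Q : A → Set} → (∀ {x y} → x ≈ y → Q x → Q y) → (∀ x → Dec (Q x)) → Dec (∃ Q)

search-Fin : ∀ {n} → Searchable (Fin n) _≡_
search-Fin resp Q? = Fin.any? Q?

search-Bool : Searchable Bool _≡_
search-Bool resp Q? with Q? true | Q? false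
... | yes q | _     = yes (true , q)
... | no _  | yes q = yes (false , q)
... | no ¬t | no ¬f = no λ { (true , q) → ¬t q ; (false , q) → ¬f q }

cons : ∀ {A : Set} {n} → A → (Fin n → A) → Fin (suc n) → A
cons x f zero    = x
cons x f (suc i) = f i

search-Π : ∀ {A : Set} {_≈_ : Rel A 0ℓ} → (∀ {x} → x ≈ x) → Searchable A _≈_ →
           ∀ n → Searchable (Fin n → A) (λ f g → ∀ i → f i ≈ g i)
search-Π ≈-refl search zero resp Q? =
  map′ (_ ,_) (λ (f , q) → resp (λ ()) q) (Q? λ ())
search-Π {A} {_≈_} ≈-refl search (suc n) {Q} resp Q? =
  map′ (λ (x , f , q) → cons x f , q)
       -- Here `f` agrees with `cons (f zero) (f ∘ suc)` only pointwise, which is why `Q` has to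
       -- respect pointwise equality.
       (λ (f , q) → f zero , f ∘ suc , resp (λ { zero → ≈-refl ; (suc i) → ≈-refl }) q)
       (search (λ x≈y (f , q) → f , resp (λ { zero → x≈y ; (suc i) → ≈-refl }) q)
               (λ x → search-Π ≈-refl search n
                        (λ f≈g → resp λ { zero → ≈-refl ; (suc i) → f≈g i })
                        (λ f → Q? (cons x f))))

-- Decidable containment and the existence of `Ex(P,n)`.

infix 4 _≋_
_≋_ : ∀ {m n} → Rel (Matrix m n) 0ℓ
A ≋ B = ∀ i j → A i j ≡ B i j

search-Matrix : ∀ m n → Searchable (Matrix m n) _≋_
search-Matrix m n = search-Π (λ _ → refl) (search-Π refl search-Bool n) m

Monotone? : ∀ {m n} (f : Fin m → Fin n) → Dec (Monotonic₁ Fin._<_ Fin._<_ f)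
Monotone? f = map′ (λ mono {i} {j} → mono i j) (λ mono i j → mono {i} {j})
  (Fin.all? λ i → Fin.all? λ j → (i Fin.<? j) →-dec (f i Fin.<? f j))

Monotone-resp : ∀ {m n} {f g : Fin m → Fin n} → f ≗ g →
                Monotonic₁ Fin._<_ Fin._<_ f → Monotonic₁ Fin._<_ Fin._<_ g
Monotone-resp f≗g mono i<j = subst₂ Fin._<_ (f≗g _) (f≗g _) (mono i<j)

Contains? : ∀ {m n α β} (A : Matrix m n) (P : Matrix α β) → Dec (Contains Fin._<_ Fin._<_ A P)
Contains? {α = α} {β} A P = search-Π refl search-Fin α
  (λ f≗f′ (g , f-mono , g-mono , entry) → g , Monotone-resp f≗f′ f-mono , g-mono ,
    λ i j Pij → subst (λ x → A x (g j) ≡ true) (f≗f′ i) (entry i j Pij))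
  λ f → search-Π refl search-Fin β
    (λ g≗g′ (f-mono , g-mono , entry) → f-mono , Monotone-resp g≗g′ g-mono ,
      λ i j Pij → subst (λ y → A (f i) y ≡ true) (g≗g′ j) (entry i j Pij))
    λ g → Monotone? f ×-dec Monotone? g ×-dec
      Fin.all? λ i → Fin.all? λ j → (P i j Bool.≟ true) →-dec (A (f i) (g j) Bool.≟ true)

Free-resp : ∀ {m n α β} {P : Matrix α β} {A B : Matrix m n} → A ≋ B → Free P A → Free P B
Free-resp A≋B free (f , g , f-mono , g-mono , entry) =
  free (f , g , f-mono , g-mono , λ i j Pij → trans (A≋B (f i) (g j)) (entry i j Pij))

filterᵇ-cong : ∀ {X : Set} {p q : X → Bool} → (∀ x → p x ≡ q x) →
               ∀ xs → filterᵇ p xs ≡ filterᵇ q xs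
filterᵇ-cong p≗q List.[] = refl
filterᵇ-cong {p = p} {q} p≗q (x List.∷ xs) with p x | q x | p≗q x
... | true  | _ | refl = cong (x List.∷_) (filterᵇ-cong p≗q xs)
... | false | _ | refl = filterᵇ-cong p≗q xs

ones-cong : ∀ {m n} {A B : Matrix m n} → A ≋ B → ones A ≡ ones B
ones-cong {m} {n} {A} {B} A≋B = cong length
  (filterᵇ-cong {p = uncurry A} {uncurry B} (λ (i , j) → A≋B i j) (cartesianProduct (allFin m) (allFin n)))

-- Distinct ones occupy distinct positions in the filtered list, so `Fin K` injects into the
-- positions of that list.
ones-lower-bound : ∀ {K m n} (A : Matrix m n) (h : Fin K → Fin m × Fin n) → Injective _≡_ _≡_ h →
                   (∀ x → uncurry A (h x) ≡ true) → K ≤ ones A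
ones-lower-bound A h h-inj one = Fin.injective⇒≤ {f = λ x → index (h∈ x)} λ {x} {y} eq →
  h-inj (Membership.index-injective (setoid _) (h∈ x) (h∈ y) eq)
  where
  h∈ : ∀ x → h x ∈ filterᵇ (uncurry A) (cartesianProduct (allFin _) (allFin _))
  h∈ x = ∈-filter⁺ (T? ∘ uncurry A) (∈-cartesianProduct⁺ (∈-allFin _) (∈-allFin _))
                   (Equivalence.from T-≡ (one x))

greatest : ∀ {Q : ℕ → Set} → (∀ e → Dec (Q e)) → ∀ N → (∀ e → Q e → e ≤ N) → ∃ Q →
           ∃[ e ] Q e × (∀ e′ → Q e′ → e′ ≤ e)
greatest Q? zero bound (e , q) = e , q , λ e′ q′ → ≤-trans (bound e′ q′) z≤n
greatest Q? (suc N) bound ∃Q with Q? (suc N)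
... | yes q = suc N , q , bound
... | no ¬q = greatest Q? N (λ e q → ≤-pred (≤∧≢⇒< (bound e q) λ { refl → ¬q q })) ∃Q

-- The counts attained by `P`-free matrices form a decidable set, by exhaustive search, bounded by
-- the number of entries; the given matrix makes it inhabited.
Ex-exists : ∀ {α β} (P : Matrix α β) n (A : Matrix n n) → Free P A →
            ∃[ e ] IsEx P n e × ones A ≤ e
Ex-exists P n A free
  with e , q , max ← greatest
    (λ e → search-Matrix n n
      (λ A≋B (fr , eq) → Free-resp {P = P} A≋B fr , trans (sym (ones-cong A≋B)) eq)
      (λ A → ¬? (Contains? A P) ×-dec (ones A ≟ e)))
    _ (λ { e (A , _ , refl) →
      length-filter (T? ∘ uncurry A) (cartesianProduct (allFin n) (allFin n)) }) (ones A , A , free , refl)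
  = e , (q , λ B fr → max (ones B) (B , fr , refl)) , max (ones A) (A , free , refl)

-- Lexicographic enumeration of the rows and columns of A[b,m]

_<ˣ_ : ∀ {m n} → Rel (Fin m × Fin n) 0ℓ
(q , r) <ˣ (q′ , r′) = q Fin.< q′ ⊎ (q ≡ q′ × r Fin.< r′)

remQuot-mono : ∀ {m} n {x y : Fin (m * n)} → x Fin.< y → remQuot {m} n x <ˣ remQuot {m} n y
remQuot-mono {m} n {x} {y} x<y = cmp (remQuot {m} n x) (remQuot {m} n y)
  (subst₂ Fin._<_ (sym (Fin.combine-remQuot {m} n x)) (sym (Fin.combine-remQuot {m} n y)) x<y)
  where
  cmp : ∀ (u v : Fin m × Fin n) → uncurry combine u Fin.< uncurry combine v → u <ˣ v
  cmp (q , r) (q′ , r′) lt with Fin.<-cmp q q′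
  ... | tri< q<q′ _ _ = inj₁ q<q′
  ... | tri> _ _ q>q′ = contradiction (Fin.combine-monoˡ-< r′ r q>q′) (<⇒≯ lt)
  ... | tri≈ _ refl _ = inj₂ (refl , +-cancelˡ-< (n * toℕ q) _ _
          (subst₂ _<_ (Fin.toℕ-combine q r) (Fin.toℕ-combine q r′) lt))

toVec : ∀ {m} b → Fin (m ^ b) → Vec (Fin m) b
toVec zero    x = []
toVec {m} (suc b) x = let q , r = remQuot {m} (m ^ b) x in q ∷ toVec b r

fromVec : ∀ {m b} → Vec (Fin m) b → Fin (m ^ b)
fromVec []       = zero
fromVec (x ∷ xs) = combine x (fromVec xs)

toVec-fromVec : ∀ {m b} (xs : Vec (Fin m) b) → toVec b (fromVec xs) ≡ xs
toVec-fromVec [] = refl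
toVec-fromVec {m} {suc b} (x ∷ xs) = trans
  (cong (λ (q , r) → q ∷ toVec b r) (Fin.remQuot-combine x (fromVec xs)))
  (cong (x ∷_) (toVec-fromVec xs))

fromVec-toVec : ∀ {m} b (x : Fin (m ^ b)) → fromVec (toVec b x) ≡ x
fromVec-toVec zero zero = refl
fromVec-toVec {m} (suc b) x = trans
  (cong (combine (proj₁ (remQuot {m} (m ^ b) x))) (fromVec-toVec b (proj₂ (remQuot {m} (m ^ b) x))))
  (Fin.combine-remQuot {m} (m ^ b) x)

toVec-mono : ∀ {m} b {x y : Fin (m ^ b)} → x Fin.< y → toVec b x <ᴸ toVec b y
toVec-mono zero {zero} {zero} ()
toVec-mono {m} (suc b) x<y with remQuot-mono {m} (m ^ b) x<y
... | inj₁ q<q′ = this q<q′ refl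
... | inj₂ (q≡q′ , r<r′) = next q≡q′ (toVec-mono b r<r′)

module _ (b m : ℕ) where

  toRow : Fin (m * m ^ b) → Row b m
  toRow x = let s , r = remQuot {m} (m ^ b) x in s , toVec b r

  fromRow : Row b m → Fin (m * m ^ b)
  fromRow (s , r) = combine s (fromVec r)

  toRow-fromRow : ∀ x → toRow (fromRow x) ≡ x
  toRow-fromRow (s , r) = trans
    (cong (λ (s′ , r′) → s′ , toVec b r′) (Fin.remQuot-combine s (fromVec r)))
    (cong (s ,_) (toVec-fromVec r))

  toRow-mono : ∀ {x y} → x Fin.< y → _<Row_ b m (toRow x) (toRow y)
  toRow-mono x<y with remQuot-mono {m} (m ^ b) x<y
  ... | inj₁ q<q′ = inj₁ q<q′
  ... | inj₂ (q≡q′ , r<r′) = inj₂ (q≡q′ , toVec-mono b r<r′)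

  toCol : Fin (m ^ b * 2 ^ b) → Col b m
  toCol x = let c , i = remQuot {m ^ b} (2 ^ b) x in toVec b c , toVec b i

  fromCol : Col b m → Fin (m ^ b * 2 ^ b)
  fromCol (c , i) = combine (fromVec c) (fromVec i)

  toCol-fromCol : ∀ x → toCol (fromCol x) ≡ x
  toCol-fromCol (c , i) = trans
    (cong (λ (c′ , i′) → toVec b c′ , toVec b i′) (Fin.remQuot-combine (fromVec c) (fromVec i)))
    (cong₂ _,_ (toVec-fromVec c) (toVec-fromVec i))

  toCol-mono : ∀ {x y} → x Fin.< y → _<Col_ b m (toCol x) (toCol y)
  toCol-mono x<y with remQuot-mono {m ^ b} (2 ^ b) x<y
  ... | inj₁ q<q′ = inj₁ (toVec-mono b q<q′)
  ... | inj₂ (q≡q′ , r<r′) = inj₂ (cong (toVec b) q≡q′ , toVec-mono b r<r′)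

-- A[b,m] in the top left corner of an n × n matrix.  Its index maps are
-- extended by an arbitrary value d outside the corner.

clip : ∀ {X : Set} {N n} → X → (Fin N → X) → Fin n → X
clip {N = N} d φ x with toℕ x <? N
... | yes x<N = φ (fromℕ< x<N)
... | no _    = d

clip-mono : ∀ {X : Set} {N n} (_≺_ : Rel X 0ℓ) (d : X) (φ : Fin N → X) →
            (∀ {x y} → x Fin.< y → φ x ≺ φ y) →
            ∀ {x y : Fin n} → toℕ y < N → x Fin.< y → clip d φ x ≺ clip d φ y
clip-mono {N = N} _≺_ d φ φ-mono {x} {y} y<N x<y with toℕ x <? N | toℕ y <? N
... | yes x<N | yes y<N′ =
  φ-mono (subst₂ _<_ (sym (Fin.toℕ-fromℕ< x<N)) (sym (Fin.toℕ-fromℕ< y<N′)) x<y)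
... | no x≮N  | _     = contradiction (<-trans x<y y<N) x≮N
... | yes _   | no y≮N = contradiction y<N y≮N

clip-inject≤ : ∀ {X : Set} {N n} (d : X) (φ : Fin N → X) (N≤n : N ≤ n) x →
               clip d φ (inject≤ x N≤n) ≡ φ x
clip-inject≤ {N = N} d φ N≤n x with toℕ (inject≤ x N≤n) <? N
... | yes lt = cong φ (Fin.toℕ-injective (trans (Fin.toℕ-fromℕ< lt) (Fin.toℕ-inject≤ x N≤n)))
... | no ≮   = contradiction (subst (_< N) (sym (Fin.toℕ-inject≤ x N≤n)) (Fin.toℕ<n x)) ≮

guard⁻ : ∀ {P Q : Set} (P? : Dec P) (Q? : Dec Q) {a} →
         does P? ∧ does Q? ∧ a ≡ true → P × Q × a ≡ true
guard⁻ (yes p) (yes q) a≡true = p , q , a≡true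

guard⁺ : ∀ {P Q : Set} (P? : Dec P) (Q? : Dec Q) {a} →
         P → Q → a ≡ true → does P? ∧ does Q? ∧ a ≡ true
guard⁺ P? Q? p q a≡true rewrite dec-true P? p | dec-true Q? q = a≡true

module Corner (b m : ℕ) (row₀ : Row b m) (col₀ : Col b m) (n : ℕ) where

  corner : Matrix n n
  corner x y = does (toℕ x <? m * m ^ b) ∧ does (toℕ y <? m ^ b * 2 ^ b) ∧
               A[_,_] b m (clip row₀ (toRow b m) x) (clip col₀ (toCol b m) y)

  corner⁻ : ∀ {x y} → corner x y ≡ true → toℕ x < m * m ^ b × toℕ y < m ^ b * 2 ^ b ×
            A[_,_] b m (clip row₀ (toRow b m) x) (clip col₀ (toCol b m) y) ≡ true
  corner⁻ {x} {y} = guard⁻ (toℕ x <? m * m ^ b) (toℕ y <? m ^ b * 2 ^ b)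

  -- Since the last column of M has a one, only empty rows can leave the corner.
  corner-free : ∀ {α β} (M : Matrix α (suc β)) k → IsCoveringAt M k → Free M corner
  corner-free M k cov (f , g , f-mono , g-mono , entry) = no-embedding M k cov b m
    (clip row₀ (toRow b m) ∘ f) (clip col₀ (toCol b m) ∘ g)
    (λ { _ (j′ , Mi′j′) i<i′ → clip-mono (_<Row_ b m) row₀ (toRow b m) (toRow-mono b m)
           (proj₁ (corner⁻ (entry _ j′ Mi′j′))) (f-mono i<i′) })
    (λ {_} {j′} j<j′ → clip-mono (_<Col_ b m) col₀ (toCol b m) (toCol-mono b m)
      (≤-<-trans (weaken j′) (proj₁ (proj₂ (corner⁻ (entry k _ (IsCoveringAt.last-one cov))))))
      (g-mono j<j′))
    (λ i j Mij → proj₂ (proj₂ (corner⁻ (entry i j Mij))))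
    where
    weaken : ∀ j → g j Fin.≤ g (fromℕ _)
    weaken j with m≤n⇒m<n∨m≡n (Fin.≤fromℕ j)
    ... | inj₁ lt = <⇒≤ (g-mono lt)
    ... | inj₂ eq = Fin.≤-reflexive (cong g (Fin.toℕ-injective eq))

  module _ (R≤n : m * m ^ b ≤ n) (C≤n : m ^ b * 2 ^ b ≤ n) where

    position : Row b m × Col b m → Fin n × Fin n
    position (x , y) = inject≤ (fromRow b m x) R≤n , inject≤ (fromCol b m y) C≤n

    position-injective : Injective _≡_ _≡_ position
    position-injective {x , y} {x′ , y′} eq = cong₂ _,_
      (trans (sym (toRow-fromRow b m x)) (trans (cong (toRow b m)
        (Fin.inject≤-injective R≤n R≤n _ _ (cong proj₁ eq))) (toRow-fromRow b m x′)))
      (trans (sym (toCol-fromCol b m y)) (trans (cong (toCol b m)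
        (Fin.inject≤-injective C≤n C≤n _ _ (cong proj₂ eq))) (toCol-fromCol b m y′)))

    corner-position : ∀ x y → A[_,_] b m x y ≡ true → uncurry corner (position (x , y)) ≡ true
    corner-position x y one = guard⁺ (_ <? m * m ^ b) (_ <? m ^ b * 2 ^ b)
      (subst (_< m * m ^ b) (sym (Fin.toℕ-inject≤ (fromRow b m x) R≤n)) (Fin.toℕ<n (fromRow b m x)))
      (subst (_< m ^ b * 2 ^ b) (sym (Fin.toℕ-inject≤ (fromCol b m y) C≤n)) (Fin.toℕ<n (fromCol b m y)))
      (trans (cong₂ (A[_,_] b m)
        (trans (clip-inject≤ row₀ (toRow b m) R≤n (fromRow b m x)) (toRow-fromRow b m x))
        (trans (clip-inject≤ col₀ (toCol b m) C≤n (fromCol b m y)) (toCol-fromCol b m y))) one)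

-- Each s ≤ t leaves at least m + (m - t) choices per coordinate:
-- i = 0 with any c, or i = 1 with c ≤ m - t.

module Count {b m t : ℕ} (t≤m : t ≤ m) where

  choice : Fin m ⊎ Fin (m ∸ t) → Fin m × Fin 2
  choice (inj₁ c) = c , zero
  choice (inj₂ c) = inject≤ c (m∸n≤m m t) , suc zero

  choice-injective : Injective _≡_ _≡_ choice
  choice-injective {inj₁ _} {inj₁ _} refl = refl
  choice-injective {inj₂ c} {inj₂ c′} eq =
    cong inj₂ (Fin.inject≤-injective (m∸n≤m m t) (m∸n≤m m t) c c′ (cong proj₁ eq))
  choice-injective {inj₁ _} {inj₂ _} eq = contradiction (cong proj₂ eq) λ ()
  choice-injective {inj₂ _} {inj₁ _} eq = contradiction (cong proj₂ eq) λ ()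

  -- Counting from 1, this says that `c + s * i` stays in `[m]`. For `i = 1` it combines `c ≤ m - t`
  -- with `s ≤ t`.
  room : ∀ (s : Fin t) u → toℕ (proj₁ (choice u)) + val s * toℕ (proj₂ (choice u)) < m
  room s (inj₁ c) = subst (_< m)
    (sym (trans (cong (toℕ c +_) (*-zeroʳ (val s))) (+-identityʳ (toℕ c))))
    (Fin.toℕ<n c)
  room s (inj₂ c) = begin-strict
    toℕ (inject≤ c (m∸n≤m m t)) + val s * 1 ≡⟨ cong₂ _+_ (Fin.toℕ-inject≤ c (m∸n≤m m t)) (*-identityʳ (val s)) ⟩
    toℕ c + val s                          <⟨ +-mono-<-≤ (Fin.toℕ<n c) (Fin.toℕ<n s) ⟩
    m ∸ t + t                              ≡⟨ m∸n+n≡m t≤m ⟩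
    m                                      ∎
    where open ≤-Reasoning

  -- The two kinds of choice per coordinate are coded in one `Fin`, so that the number of seeds is
  -- visibly `t * (m + (m ∸ t)) ^ b`.
  Seed : Set
  Seed = Fin t × Vec (Fin (m + (m ∸ t))) b

  at : Seed → Fin b → Fin m ⊎ Fin (m ∸ t)
  at (s , d) p = splitAt m (lookup d p)

  rowOf : Seed → Row b m
  rowOf (s , d) = inject≤ s t≤m , tabulate (λ p → fromℕ< (room s (at (s , d) p)))

  colOf : Seed → Col b m
  colOf x = tabulate (proj₁ ∘ choice ∘ at x) , tabulate (proj₂ ∘ choice ∘ at x)

  seed-one : ∀ x → A[_,_] b m (rowOf x) (colOf x) ≡ true
  seed-one x@(s , d) = A⁺
    (inject≤ s t≤m) (proj₂ (rowOf x)) (proj₁ (colOf x)) (proj₂ (colOf x)) λ p → cong suc (begin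
    toℕ (lookup (proj₂ (rowOf x)) p)
      ≡⟨ cong toℕ (lookup∘tabulate _ p) ⟩
    toℕ (fromℕ< (room s (at x p)))
      ≡⟨ Fin.toℕ-fromℕ< (room s (at x p)) ⟩
    toℕ (proj₁ (choice (at x p))) + val s * toℕ (proj₂ (choice (at x p)))
      ≡⟨ cong₂ _+_ (cong toℕ (sym (lookup∘tabulate (proj₁ ∘ choice ∘ at x) p)))
           (cong₂ _*_ (cong suc (sym (Fin.toℕ-inject≤ s t≤m)))
                      (cong toℕ (sym (lookup∘tabulate (proj₂ ∘ choice ∘ at x) p)))) ⟩
    toℕ (lookup (proj₁ (colOf x)) p) + val (inject≤ s t≤m) * toℕ (lookup (proj₂ (colOf x)) p) ∎)
    where open ≡-Reasoning

  tabulate-injective : ∀ {X : Set} {k} {f g : Fin k → X} → tabulate f ≡ tabulate g → f ≗ g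
  tabulate-injective {f = f} {g} eq p =
    trans (sym (lookup∘tabulate f p)) (trans (cong (λ v → lookup v p) eq) (lookup∘tabulate g p))

  seed-injective : Injective _≡_ _≡_ (λ x → rowOf x , colOf x)
  seed-injective {s , d} {s′ , d′} eq = cong₂ _,_
    (Fin.inject≤-injective t≤m t≤m s s′ (cong (proj₁ ∘ proj₁) eq))
    (lookup-injective d d′ λ p → splitAt-injective (choice-injective (cong₂ _,_
      (tabulate-injective (cong (proj₁ ∘ proj₂) eq) p)
      (tabulate-injective (cong (proj₂ ∘ proj₂) eq) p))))
    where
    splitAt-injective : ∀ {x y} → splitAt m x ≡ splitAt m y → x ≡ y
    splitAt-injective {x} {y} eq = trans (sym (Fin.join-splitAt m (m ∸ t) x))
      (trans (cong (join m (m ∸ t)) eq) (Fin.join-splitAt m (m ∸ t) y))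

  toSeed : Fin (t * (m + (m ∸ t)) ^ b) → Seed
  toSeed x = let s , d = remQuot {t} ((m + (m ∸ t)) ^ b) x in s , toVec b d

  toSeed-injective : Injective _≡_ _≡_ toSeed
  toSeed-injective {x} {y} eq = trans (sym (Fin.combine-remQuot {t} N x)) (trans
    (cong₂ combine (cong proj₁ eq) (trans (sym (fromVec-toVec b (proj₂ (remQuot {t} N x))))
      (trans (cong fromVec (cong proj₂ eq)) (fromVec-toVec b (proj₂ (remQuot {t} N y))))))
    (Fin.combine-remQuot {t} N y))
    where N = (m + (m ∸ t)) ^ b

Ex-lower-bound : ∀ {α β} (M : Matrix α (suc β)) → IsCovering M → ∀ b m t n → 1 ≤ m → t ≤ m →
                 m * m ^ b ≤ n → m ^ b * 2 ^ b ≤ n →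
                 ∃[ e ] IsEx M n e × t * (m + (m ∸ t)) ^ b ≤ e
Ex-lower-bound M (_ , k , cov) b m@(suc _) t n 1≤m t≤m R≤n C≤n
  = let e , isEx , ones≤e = Ex-exists M n corner (corner-free M k cov) in
    e , isEx , ≤-trans (ones-lower-bound corner
      (position R≤n C≤n ∘ (λ x → rowOf x , colOf x) ∘ toSeed)
      (toSeed-injective ∘ seed-injective ∘ position-injective R≤n C≤n)
      (λ x → corner-position R≤n C≤n (rowOf (toSeed x)) (colOf (toSeed x)) (seed-one (toSeed x)))) ones≤e
  where
  -- As `m` is a successor, `zero` is available to build the default row and column outside the
  -- corner.
  open Corner b m (zero , tabulate (λ _ → zero)) (tabulate (λ _ → zero) , tabulate (λ _ → zero)) n
  open Count {b} t≤m

-- Elementary inequalities between powers.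

^-distribʳ-* : ∀ k x y → (x * y) ^ k ≡ x ^ k * y ^ k
^-distribʳ-* zero    x y = refl
^-distribʳ-* (suc k) x y =
  trans (cong (x * y *_) (^-distribʳ-* k x y)) (interchange x y (x ^ k) (y ^ k))

-- The factor x on both sides avoids x ^ (b ∸ 1).
bernoulli : ∀ b y t → (y + t) * (y + t) ^ b ≤ (y + t) * y ^ b + t * b * (y + t) ^ b
bernoulli zero y t = m≤m+n _ _
bernoulli (suc b) y t = begin
  x * (x * x ^ b)                          ≤⟨ *-monoʳ-≤ x (bernoulli b y t) ⟩
  x * (x * y ^ b + t * b * x ^ b)          ≡⟨ split y t b (y ^ b) (x ^ b) ⟩
  x * (y * y ^ b) + (x * t * y ^ b + t * b * (x * x ^ b))
    ≤⟨ +-monoʳ-≤ (x * (y * y ^ b)) (+-monoˡ-≤ (t * b * (x * x ^ b))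
         (*-monoʳ-≤ (x * t) (^-monoˡ-≤ b (m≤m+n y t)))) ⟩
  x * (y * y ^ b) + (x * t * x ^ b + t * b * (x * x ^ b))
    ≡⟨ cong (x * (y * y ^ b) +_) (merge x t b (x ^ b)) ⟩
  x * (y * y ^ b) + t * suc b * (x * x ^ b) ∎
  where
  open ≤-Reasoning
  x = y + t
  split : ∀ y t b Y X → (y + t) * ((y + t) * Y + t * b * X) ≡
          (y + t) * (y * Y) + ((y + t) * t * Y + t * b * ((y + t) * X))
  split = solve-∀
  merge : ∀ x t b X → x * t * X + t * b * (x * X) ≡ t * suc b * (x * X)
  merge = solve-∀

-- When `2 * (t * b)` is at most `y + t`, the error term in `bernoulli` is at most half of the left
-- side. Doubling the inequality and cancelling that half leaves the claim.
^-≤-double : ∀ b y t → 1 ≤ y → 2 * (t * b) ≤ y + t → (y + t) ^ b ≤ 2 * y ^ b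
^-≤-double b y@(suc _) t _ 2tb≤x = *-cancelˡ-≤ x (+-cancelʳ-≤ (x * x ^ b) _ _ (begin
  x * x ^ b + x * x ^ b                   ≡⟨ cong (x * x ^ b +_) (+-identityʳ (x * x ^ b)) ⟨
  2 * (x * x ^ b)                         ≤⟨ *-monoʳ-≤ 2 (bernoulli b y t) ⟩
  2 * (x * y ^ b + t * b * x ^ b)         ≡⟨ regroup x t b (y ^ b) (x ^ b) ⟩
  x * (2 * y ^ b) + 2 * (t * b) * x ^ b   ≤⟨ +-monoʳ-≤ (x * (2 * y ^ b)) (*-monoˡ-≤ (x ^ b) 2tb≤x) ⟩
  x * (2 * y ^ b) + x * x ^ b             ∎))
  where
  open ≤-Reasoning
  x = y + t
  regroup : ∀ x t b Y X → 2 * (x * Y + t * b * X) ≡ x * (2 * Y) + 2 * (t * b) * X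
  regroup = solve-∀

n<2^n : ∀ n → n < 2 ^ n
n<2^n zero    = s≤s z≤n
n<2^n (suc n) = begin-strict
  suc n         <⟨ s≤s (n<2^n n) ⟩
  1 + 2 ^ n     ≤⟨ +-monoˡ-≤ (2 ^ n) (m^n>0 2 n) ⟩
  2 ^ n + 2 ^ n ≡⟨ cong (2 ^ n +_) (+-identityʳ (2 ^ n)) ⟨
  2 * 2 ^ n     ∎
  where open ≤-Reasoning

2[1+n]≤2^n : ∀ n → 4 ≤ n → 2 * suc n ≤ 2 ^ n
2[1+n]≤2^n n 4≤n with k , refl ← m≤n⇒∃[o]m+o≡n 4≤n = go k
  where
  open ≤-Reasoning
  go : ∀ k → 2 * (5 + k) ≤ 2 ^ (4 + k)
  go zero    = m≤m+n 10 6
  go (suc k) = begin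
    2 * (6 + k)                 ≡⟨ expand k ⟩
    2 * (5 + k) + 2             ≤⟨ +-mono-≤ (go k) (^-monoʳ-≤ 2 {1} {4 + k} (s≤s z≤n)) ⟩
    2 ^ (4 + k) + 2 ^ (4 + k)   ≡⟨ cong (2 ^ (4 + k) +_) (+-identityʳ (2 ^ (4 + k))) ⟨
    2 ^ (5 + k)                 ∎
    where
    expand : ∀ k → 2 * (6 + k) ≡ 2 * (5 + k) + 2
    expand = solve-∀

-- The choice of `b`, `m` and `t` for a given `n`.

2^m≤n⇒m≤n : ∀ {m n} → 2 ^ m ≤ n → m ≤ n
2^m≤n⇒m≤n {m} le = ≤-trans (<⇒≤ (n<2^n m)) le

-- The exponent is `4 * 5`, which makes `b = 4` admissible and so guarantees `4 ≤ b` for the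
-- greatest `b`.
threshold : ℕ
threshold = 2 ^ 20

record Parameters (n : ℕ) : Set where
  field
    b m t     : ℕ
    4≤b       : 4 ≤ b
    n-lower   : 2 ^ (b * suc b) ≤ n
    n-upper   : n < 2 ^ (suc b * suc (suc b))
    1≤m       : 1 ≤ m
    t≤m       : t ≤ m
    rows≤n    : m * m ^ b ≤ n
    columns≤n : m ^ b * 2 ^ b ≤ n
    many      : 2 ^ b * n ≤ 8 * b * (t * (m + (m ∸ t)) ^ b)

module Choose (n : ℕ) (b : ℕ) (4≤b : 4 ≤ b) (n-lower : 2 ^ (b * suc b) ≤ n)
              (n-upper : n < 2 ^ (suc b * suc (suc b)))
              (m : ℕ) (2^b≤m : 2 ^ b ≤ m) (rows≤n : m * m ^ b ≤ n) (n<next : n < suc m * suc m ^ b) where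

  instance
    b≢0 : NonZero b
    b≢0 = >-nonZero (≤-trans (s≤s z≤n) 4≤b)

  -- A larger `t` adds rows but shrinks `(2m - t)^b`. With `t * b ≤ m` this power stays within a
  -- factor 2 of `(2m)^b`, and `t` is still of order `m / b`.
  t : ℕ
  t = m / b

  b≤m : b ≤ m
  b≤m = 2^m≤n⇒m≤n 2^b≤m

  1≤m : 1 ≤ m
  1≤m = ≤-trans (m^n>0 2 b) 2^b≤m

  -- The remainder of `m` modulo `b` is below `b`, hence at most `t * b` because `t ≥ 1`.
  m≤2tb : m ≤ 2 * (t * b)
  m≤2tb = begin
    m                 ≡⟨ m≡m%n+[m/n]*n m b ⟩
    m % b + t * b     ≤⟨ +-monoˡ-≤ (t * b) (<⇒≤ (m%n<n m b)) ⟩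
    b + t * b         ≤⟨ +-monoˡ-≤ (t * b) (m≤n*m b t {{>-nonZero (m≥n⇒m/n>0 b≤m)}}) ⟩
    t * b + t * b     ≡⟨ cong (t * b +_) (+-identityʳ (t * b)) ⟨
    2 * (t * b)       ∎
    where open ≤-Reasoning

  Y : ℕ
  Y = m + (m ∸ t)

  Y+t≡2m : Y + t ≡ 2 * m
  Y+t≡2m = trans (+-assoc m (m ∸ t) t) (cong (m +_) (trans (m∸n+n≡m (m/n≤m m b)) (sym (+-identityʳ m))))

  -- Passing from `m` to `m + 1` at most doubles the power with exponent `b + 1`, since
  -- `2(b + 1) ≤ 2^b ≤ m`.
  n≤ : n ≤ 2 * (m * m ^ b)
  n≤ = begin
    n                  ≤⟨ <⇒≤ n<next ⟩
    suc m ^ suc b      ≡⟨ cong (_^ suc b) (+-comm 1 m) ⟩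
    (m + 1) ^ suc b    ≤⟨ ^-≤-double (suc b) m 1 1≤m (begin
        2 * (1 * suc b) ≡⟨ cong (2 *_) (*-identityˡ (suc b)) ⟩
        2 * suc b       ≤⟨ 2[1+n]≤2^n b 4≤b ⟩
        2 ^ b           ≤⟨ 2^b≤m ⟩
        m               ≤⟨ m≤m+n m 1 ⟩
        m + 1           ∎) ⟩
    2 * (m * m ^ b)    ∎
    where open ≤-Reasoning

  -- The constant 8 collects three factors 2: from `n≤`, from `m≤2tb`, and from replacing `(2m)^b`
  -- by `Y^b`.
  many : 2 ^ b * n ≤ 8 * b * (t * Y ^ b)
  many = begin
    2 ^ b * n                       ≤⟨ *-monoʳ-≤ (2 ^ b) n≤ ⟩
    2 ^ b * (2 * (m * m ^ b))       ≡⟨ e₁ (2 ^ b) m (m ^ b) ⟩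
    2 * m * (2 ^ b * m ^ b)         ≡⟨ cong (2 * m *_) (^-distribʳ-* b 2 m) ⟨
    2 * m * (2 * m) ^ b             ≡⟨ cong (λ x → 2 * m * x ^ b) Y+t≡2m ⟨
    2 * m * (Y + t) ^ b             ≤⟨ *-mono-≤ (*-monoʳ-≤ 2 m≤2tb)
                                         (^-≤-double b Y t (≤-trans 1≤m (m≤m+n m _)) (begin
          2 * (t * b) ≤⟨ *-monoʳ-≤ 2 (m/n*n≤m m b) ⟩
          2 * m       ≡⟨ Y+t≡2m ⟨
          Y + t       ∎)) ⟩
    2 * (2 * (t * b)) * (2 * Y ^ b) ≡⟨ e₂ t b (Y ^ b) ⟩
    8 * b * (t * Y ^ b)             ∎
    where
    open ≤-Reasoning
    e₁ : ∀ B m X → B * (2 * (m * X)) ≡ 2 * m * (B * X)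
    e₁ = solve-∀
    e₂ : ∀ t b X → 2 * (2 * (t * b)) * (2 * X) ≡ 8 * b * (t * X)
    e₂ = solve-∀

  parameters : Parameters n
  parameters = record
    { b = b ; m = m ; t = t ; 4≤b = 4≤b ; n-lower = n-lower ; n-upper = n-upper
    -- Columns fit because `2^b ≤ m` bounds `m^b * 2^b` by the number of rows.
    ; 1≤m = 1≤m ; t≤m = m/n≤m m b ; rows≤n = rows≤n
    ; columns≤n = ≤-trans (*-monoʳ-≤ (m ^ b) 2^b≤m) (≤-trans (≤-reflexive (*-comm (m ^ b) m)) rows≤n)
    ; many = many }

-- It shows that `2^b` is a candidate for `m`, so the greatest `m` satisfies `2^b ≤ m`.
2^[b*suc-b] : ∀ b → 2 ^ (b * suc b) ≡ 2 ^ b * (2 ^ b) ^ b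
2^[b*suc-b] b = trans (cong (2 ^_) (*-suc b b))
  (trans (^-distribˡ-+-* 2 b (b * b)) (cong (2 ^ b *_) (sym (^-*-assoc 2 b b))))

choose : ∀ n → threshold ≤ n → Parameters n
choose n large
  with b , n-lower , b-max ← greatest (λ b → 2 ^ (b * suc b) ≤? n) n
         (λ b le → ≤-trans (m≤m*n b (suc b)) (2^m≤n⇒m≤n le)) (4 , large)
  with m , rows≤n , m-max ← greatest (λ m → m * m ^ b ≤? n) n
         (λ { zero _ → z≤n ; m@(suc _) le → ≤-trans (m≤m*n m (m ^ b) {{m^n≢0 m b}}) le })
         (2 ^ b , subst (_≤ n) (2^[b*suc-b] b) n-lower)
  = Choose.parameters n b (b-max 4 large) n-lower (≰⇒> λ le → 1+n≰n (b-max (suc b) le))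
      m (m-max (2 ^ b) (subst (_≤ n) (2^[b*suc-b] b) n-lower)) rows≤n
      (≰⇒> λ le → 1+n≰n (m-max (suc m) le))

-- From cuts of logarithms, roots and powers to inequalities in ℕ.

^-cancelʳ-< : ∀ k {x y} → x ^ k < y ^ k → x < y
^-cancelʳ-< k lt = ≰⇒> λ y≤x → <⇒≱ lt (^-monoˡ-≤ k y≤x)

2^-cancel-< : ∀ {k l} → 2 ^ k < 2 ^ l → k < l
2^-cancel-< lt = ≰⇒> λ l≤k → <⇒≱ lt (^-monoʳ-≤ 2 l≤k)

-- With these parts `2^ℤ z` becomes the fraction of `2 ^ (z ⁺)` by `2 ^ (z ⁻)`, and comparisons can
-- be cleared of denominators in ℕ.
_⁺ _⁻ : ℤ → ℕ
(ℤ.+ n) ⁺    = n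
-[1+ n ] ⁺   = 0
(ℤ.+ n) ⁻    = 0
-[1+ n ] ⁻   = suc n

⁺-⁻ : ∀ z → z ≡ ℤ.+ (z ⁺) ℤ.- ℤ.+ (z ⁻)
⁺-⁻ (ℤ.+ n)  = sym (ℤ.+-identityʳ (ℤ.+ n))
⁺-⁻ -[1+ n ] = refl

-- Denominators are stored minus one, so the denominator `suc d ^ k` enters through its predecessor
-- `e`.
frac-^ : ∀ x d k → ∃[ e ] suc e ≡ suc d ^ k × mkℚᵘ (ℤ.+ x) d ^ℚ k ≡ mkℚᵘ (ℤ.+ (x ^ k)) e
frac-^ x d zero = 0 , refl , refl
frac-^ x d (suc k) with e , e≡ , eq ← frac-^ x d k =
  e + d * suc e , cong (suc d *_) e≡ ,
  trans (cong (mkℚᵘ (ℤ.+ x) d ℚ.*_) eq) (cong (λ z → mkℚᵘ z (e + d * suc e)) (sym (ℤ.pos-* x (x ^ k))))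

2^ℤ-frac : ∀ z → ∃[ e ] suc e ≡ 2 ^ (z ⁻) × 2^ℤ z ≡ mkℚᵘ (ℤ.+ (2 ^ (z ⁺))) e
2^ℤ-frac (ℤ.+ n) with e , e≡ , eq ← frac-^ 2 0 n = e , trans e≡ (^-zeroˡ n) , eq
2^ℤ-frac -[1+ n ] with e , e≡ , eq ← frac-^ 1 1 (suc n) =
  e , e≡ , trans eq (cong (λ x → mkℚᵘ (ℤ.+ x) e) (^-zeroˡ (suc n)))

frac-<2^ : ∀ x d z w → mkℚᵘ (ℤ.+ x) d <2^ mkℚᵘ z w →
           x ^ suc w * 2 ^ (z ⁻) < 2 ^ (z ⁺) * suc d ^ suc w
frac-<2^ x d z w (inj₁ neg) = contradiction (frac-<⁻ neg) λ ()
frac-<2^ x d z w (inj₂ lt)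
  with e₁ , e₁≡ , eq₁ ← frac-^ x d (suc w) | e₂ , e₂≡ , eq₂ ← 2^ℤ-frac z =
  subst₂ (λ s t → x ^ suc w * s < 2 ^ (z ⁺) * t) e₂≡ e₁≡ (frac-<⁻ (subst₂ ℚ._<_ eq₁ eq₂ lt))

frac->2^ : ∀ x d z w → mkℚᵘ (ℤ.+ x) d >2^ mkℚᵘ z w →
           2 ^ (z ⁺) * suc d ^ suc w < x ^ suc w * 2 ^ (z ⁻)
frac->2^ x d z w (_ , lt)
  with e₁ , e₁≡ , eq₁ ← frac-^ x d (suc w) | e₂ , e₂≡ , eq₂ ← 2^ℤ-frac z =
  subst₂ (λ s t → 2 ^ (z ⁺) * t < x ^ suc w * s) e₂≡ e₁≡ (frac-<⁻ (subst₂ ℚ._<_ eq₂ eq₁ lt))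

-- The cut supplies a rational between `2^(k / suc d)` and `n`. Raising to the power `suc d` and
-- cancelling its denominator removes it.
below-log : ∀ n k d → lower (log₂ (fromNat n)) (mkℚᵘ (ℤ.+ k) d) → 2 ^ k < n ^ suc d
below-log n k d (mkℚᵘ -[1+ x ] e , _ , (*<* () , _))
below-log n k d (mkℚᵘ (ℤ.+ x) e , x<n , x>2^) = *-cancelʳ-< _ (2 ^ k) (n ^ suc d) (begin-strict
  2 ^ k * suc e ^ suc d     <⟨ frac->2^ x e (ℤ.+ k) d x>2^ ⟩
  x ^ suc d * 1             ≡⟨ *-identityʳ (x ^ suc d) ⟩
  x ^ suc d                 ≡⟨ cong (_^ suc d) (*-identityʳ x) ⟨
  (x * 1) ^ suc d           ≤⟨ ^-monoˡ-≤ (suc d) (<⇒≤ (frac-<⁻ x<n)) ⟩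
  (n * suc e) ^ suc d       ≡⟨ ^-distribʳ-* (suc d) n (suc e) ⟩
  n ^ suc d * suc e ^ suc d ∎)
  where open ≤-Reasoning

above-log : ∀ n z d → upper (log₂ (fromNat n)) (mkℚᵘ z d) → n ^ suc d * 2 ^ (z ⁻) < 2 ^ (z ⁺)
above-log n z d (mkℚᵘ -[1+ x ] e , *<* n<x , _) =
  contradiction (subst (ℤ._< -[1+ x ] ℤ.* ℤ.+ 1) (sym (ℤ.pos-* n (suc e))) n<x) λ ()
above-log n z d (mkℚᵘ (ℤ.+ x) e , n<x , x<2^) = *-cancelʳ-< _ _ (2 ^ (z ⁺)) (begin-strict
  n ^ suc d * 2 ^ (z ⁻) * suc e ^ suc d   ≡⟨ xy∙z≈xz∙y (n ^ suc d) (2 ^ (z ⁻)) (suc e ^ suc d) ⟩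
  n ^ suc d * suc e ^ suc d * 2 ^ (z ⁻)   ≡⟨ cong (_* 2 ^ (z ⁻)) (^-distribʳ-* (suc d) n (suc e)) ⟨
  (n * suc e) ^ suc d * 2 ^ (z ⁻)         ≤⟨ *-monoˡ-≤ (2 ^ (z ⁻)) (^-monoˡ-≤ (suc d)
                                               (≤-trans (<⇒≤ (frac-<⁻ n<x)) (≤-reflexive (*-identityʳ x)))) ⟩
  x ^ suc d * 2 ^ (z ⁻)                   <⟨ frac-<2^ x e z d x<2^ ⟩
  2 ^ (z ⁺) * suc e ^ suc d               ∎)
  where
  open ≤-Reasoning

-- From `log n ≥ b(b + 1) ≥ b²`, any rational above `log n` is at least `b²`, so `b²` lies below
-- `2^(z / suc d)`. This is the form of `log log n ≥ 2 log b` used later.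
above-log-log : ∀ {n b} → 2 ^ (b * suc b) ≤ n → ∀ z d → upper (log₂ (log₂ (fromNat n))) (mkℚᵘ z d) →
                (b * b) ^ suc d * 2 ^ (z ⁻) < 2 ^ (z ⁺)
-- A negative upper bound for `log n` would contradict `n ≥ 1`.
above-log-log {n} {b} n-lower z d (mkℚᵘ -[1+ k ] e , above , _) = contradiction (above-log n -[1+ k ] e above)
  (≤⇒≯ (*-mono-≤ {1} {_} {1} (≤-trans (≤-reflexive (sym (^-zeroˡ (suc e))))
    (^-monoˡ-≤ (suc e) (≤-trans (m^n>0 2 (b * suc b)) n-lower))) (m^n>0 2 (suc k))))
above-log-log {n} {b} n-lower z d (mkℚᵘ (ℤ.+ k) e , above , k<2^) = *-cancelʳ-< _ _ (2 ^ (z ⁺)) (begin-strict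
  (b * b) ^ suc d * 2 ^ (z ⁻) * suc e ^ suc d   ≡⟨ xy∙z≈xz∙y ((b * b) ^ suc d) (2 ^ (z ⁻)) (suc e ^ suc d) ⟩
  (b * b) ^ suc d * suc e ^ suc d * 2 ^ (z ⁻)   ≡⟨ cong (_* 2 ^ (z ⁻)) (^-distribʳ-* (suc d) (b * b) (suc e)) ⟨
  (b * b * suc e) ^ suc d * 2 ^ (z ⁻)           ≤⟨ *-monoˡ-≤ (2 ^ (z ⁻)) (^-monoˡ-≤ (suc d) b²e≤k) ⟩
  k ^ suc d * 2 ^ (z ⁻)                         <⟨ frac-<2^ k e z d k<2^ ⟩
  2 ^ (z ⁺) * suc e ^ suc d                     ∎)
  where
  open ≤-Reasoning
  b²e≤k : b * b * suc e ≤ k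
  b²e≤k = ≤-trans (*-monoˡ-≤ (suc e) (*-monoʳ-≤ b (n≤1+n b))) (<⇒≤ (2^-cancel-< (begin-strict
    2 ^ (b * suc b * suc e)   ≡⟨ ^-*-assoc 2 (b * suc b) (suc e) ⟨
    (2 ^ (b * suc b)) ^ suc e ≤⟨ ^-monoˡ-≤ (suc e) n-lower ⟩
    n ^ suc e                 ≡⟨ *-identityʳ (n ^ suc e) ⟨
    n ^ suc e * 1             <⟨ above-log n (ℤ.+ k) e above ⟩
    2 ^ k                     ∎)))

-- If `u = k / D` reached `b + 2`, then `u² < log n` would give `2^(k²) < n^(D²)`, while
-- `log n < (b + 1)(b + 2) ≤ u²` gives the reverse.
below-√log : ∀ {n b} → n < 2 ^ (suc b * suc (suc b)) → ∀ u → lower (√ (log₂ (fromNat n))) u →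
             u ℚ.< ℕ→ℚ (2 + b)
below-√log n-upper u (inj₁ u<0) = ℚ.<-≤-trans u<0 (frac-≤⁺ z≤n)
below-√log n-upper (mkℚᵘ -[1+ k ] d) (inj₂ _) = *<* ℤ.-<+
below-√log {n} {b} n-upper (mkℚᵘ (ℤ.+ k) d) (inj₂ u²<log) = frac-<⁺ (≰⇒> λ le → <⇒≱ k²<n (begin
  n ^ (D * D)                                     ≤⟨ ^-monoˡ-≤ (D * D) (<⇒≤ n-upper) ⟩
  (2 ^ (suc b * suc (suc b))) ^ (D * D)           ≡⟨ ^-*-assoc 2 (suc b * suc (suc b)) (D * D) ⟩
  2 ^ (suc b * suc (suc b) * (D * D))             ≤⟨ ^-monoʳ-≤ 2 (begin
    suc b * suc (suc b) * (D * D)        ≤⟨ *-monoˡ-≤ (D * D) (*-monoˡ-≤ (2 + b) (n≤1+n (suc b))) ⟩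
    (2 + b) * (2 + b) * (D * D)          ≡⟨ interchange (2 + b) (2 + b) D D ⟩
    ((2 + b) * D) * ((2 + b) * D)        ≤⟨ *-mono-≤ le le ⟩
    k * 1 * (k * 1)                      ≡⟨ cong₂ _*_ (*-identityʳ k) (*-identityʳ k) ⟩
    k * k                                ∎) ⟩
  2 ^ (k * k)                                     ∎))
  where
  open ≤-Reasoning
  D = suc d
  k²<n : 2 ^ (k * k) < n ^ (D * D)
  -- The successor of `d + d * D` is `D * D`, the denominator of the square.
  k²<n = below-log n (k * k) (d + d * D)
    (subst (λ z → lower (log₂ (fromNat n)) (mkℚᵘ z (d + d * D))) (sym (ℤ.pos-* k k)) u²<log)

-- a + 2w < c for a = za / suc da and w = zw / suc dw, with the negative parts of
-- the numerators moved across.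
exponent-bound : ∀ c za da zw dw → mkℚᵘ za da ℚ.< ℕ→ℚ c ℚ.- ℕ→ℚ 2 ℚ.* mkℚᵘ zw dw →
                 (za ⁺) * suc dw + 2 * (zw ⁺) * suc da <
                 c * (suc da * suc dw) + ((za ⁻) * suc dw + 2 * (zw ⁻) * suc da)
exponent-bound c za da zw dw (*<* lt) rewrite +-identityʳ dw | +-identityʳ dw =
  ℤ.drop‿+<+ (subst₂ ℤ._<_ left right (ℤ.+-monoˡ-< shift lt))
  where
  D W P N Q M : ℤ
  D = ℤ.+ suc da
  W = ℤ.+ suc dw
  P = ℤ.+ (za ⁺)
  N = ℤ.+ (za ⁻)
  Q = ℤ.+ (zw ⁺)
  M = ℤ.+ (zw ⁻)
  shift = N ℤ.* W ℤ.+ ℤ.+ 2 ℤ.* M ℤ.* D ℤ.+ ℤ.+ 2 ℤ.* zw ℤ.* D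
  pos-linear : ∀ p q → ℤ.+ (p * suc dw + 2 * q * suc da) ≡ ℤ.+ p ℤ.* W ℤ.+ ℤ.+ 2 ℤ.* ℤ.+ q ℤ.* D
  pos-linear p q = cong₂ ℤ._+_ (ℤ.pos-* p (suc dw))
    (trans (ℤ.pos-* (2 * q) (suc da)) (cong (ℤ._* D) (ℤ.pos-* 2 q)))
  left : za ℤ.* W ℤ.+ shift ≡ ℤ.+ ((za ⁺) * suc dw + 2 * (zw ⁺) * suc da)
  left = trans (cong₂ (λ x y → x ℤ.* W ℤ.+ (N ℤ.* W ℤ.+ ℤ.+ 2 ℤ.* M ℤ.* D ℤ.+ ℤ.+ 2 ℤ.* y ℤ.* D))
      (⁺-⁻ za) (⁺-⁻ zw))
    (trans (lemma P N Q M D W) (sym (pos-linear (za ⁺) (zw ⁺))))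
    where
    lemma : ∀ P N Q M D W → (P ℤ.- N) ℤ.* W ℤ.+ (N ℤ.* W ℤ.+ ℤ.+ 2 ℤ.* M ℤ.* D ℤ.+ ℤ.+ 2 ℤ.* (Q ℤ.- M) ℤ.* D) ≡
            P ℤ.* W ℤ.+ ℤ.+ 2 ℤ.* Q ℤ.* D
    lemma = ℤ-Solver.solve-∀
  right : (ℤ.+ c ℤ.* W ℤ.+ (ℤ.- (ℤ.+ 2 ℤ.* zw)) ℤ.* ℤ.+ 1) ℤ.* D ℤ.+ shift ≡
          ℤ.+ (c * (suc da * suc dw) + ((za ⁻) * suc dw + 2 * (zw ⁻) * suc da))
  right = trans (lemma (ℤ.+ c) zw N M D W) (sym (cong₂ ℤ._+_
    (trans (ℤ.pos-* c (suc da * suc dw)) (cong (ℤ.+ c ℤ.*_) (ℤ.pos-* (suc da) (suc dw))))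
    (pos-linear (za ⁻) (zw ⁻))))
    where
    lemma : ∀ c z N M D W → (c ℤ.* W ℤ.+ (ℤ.- (ℤ.+ 2 ℤ.* z)) ℤ.* ℤ.+ 1) ℤ.* D ℤ.+
              (N ℤ.* W ℤ.+ ℤ.+ 2 ℤ.* M ℤ.* D ℤ.+ ℤ.+ 2 ℤ.* z ℤ.* D) ≡
            c ℤ.* (D ℤ.* W) ℤ.+ (N ℤ.* W ℤ.+ ℤ.+ 2 ℤ.* M ℤ.* D)
    lemma = ℤ-Solver.solve-∀

-- x / y < 2^((Pa - Na)/D), B < 2^((Pw - Nw)/W) and
-- (Pa - Na)/D + 2 (Pw - Nw)/W < c give (x / y) B² < 2^c.
combine-powers : ∀ {x y B Pa Na Pw Nw c} D W → .{{NonZero D}} → .{{NonZero W}} →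
  x ^ D * 2 ^ Na < 2 ^ Pa * y ^ D → B ^ W * 2 ^ Nw < 2 ^ Pw →
  Pa * W + 2 * Pw * D < c * (D * W) + (Na * W + 2 * Nw * D) →
  x * B ^ 2 < 2 ^ c * y
combine-powers {x} {y} {B} {Pa} {Na} {Pw} {Nw} {c} D W x< B< exponents =
  ^-cancelʳ-< (D * W) (*-cancelʳ-< (2 ^ (Na * W + 2 * Nw * D)) _ _ (begin-strict
    (x * B ^ 2) ^ (D * W) * 2 ^ (Na * W + 2 * Nw * D)
      ≡⟨ cong₂ _*_ (^-distribʳ-* (D * W) x (B ^ 2)) (^-distribˡ-+-* 2 (Na * W) (2 * Nw * D)) ⟩
    x ^ (D * W) * (B ^ 2) ^ (D * W) * (2 ^ (Na * W) * 2 ^ (2 * Nw * D))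
      ≡⟨ interchange (x ^ (D * W)) ((B ^ 2) ^ (D * W)) (2 ^ (Na * W)) (2 ^ (2 * Nw * D)) ⟩
    x ^ (D * W) * 2 ^ (Na * W) * ((B ^ 2) ^ (D * W) * 2 ^ (2 * Nw * D))
      ≡⟨ cong₂ _*_
           (cong₂ _*_ (sym (^-*-assoc x D W)) (sym (^-*-assoc 2 Na W)))
           (cong₂ _*_
             (trans (^-*-assoc B 2 (D * W)) (trans (cong (B ^_) (e₁ D W)) (sym (^-*-assoc B W (2 * D)))))
             (trans (cong (2 ^_) (e₂ Nw D)) (sym (^-*-assoc 2 Nw (2 * D))))) ⟩
    (x ^ D) ^ W * (2 ^ Na) ^ W * ((B ^ W) ^ (2 * D) * (2 ^ Nw) ^ (2 * D))
      ≡⟨ cong₂ _*_ (^-distribʳ-* W (x ^ D) (2 ^ Na)) (^-distribʳ-* (2 * D) (B ^ W) (2 ^ Nw)) ⟨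
    (x ^ D * 2 ^ Na) ^ W * (B ^ W * 2 ^ Nw) ^ (2 * D)
      <⟨ *-mono-< (^-monoˡ-< W x<) (^-monoˡ-< (2 * D) {{m*n≢0 2 D}} B<) ⟩
    (2 ^ Pa * y ^ D) ^ W * (2 ^ Pw) ^ (2 * D)
      ≡⟨ cong₂ _*_ (^-distribʳ-* W (2 ^ Pa) (y ^ D))
           (trans (^-*-assoc 2 Pw (2 * D)) (cong (2 ^_) (sym (e₂ Pw D)))) ⟩
    (2 ^ Pa) ^ W * (y ^ D) ^ W * 2 ^ (2 * Pw * D)
      ≡⟨ cong₂ (λ s t → s * t * 2 ^ (2 * Pw * D)) (^-*-assoc 2 Pa W) (^-*-assoc y D W) ⟩
    2 ^ (Pa * W) * y ^ (D * W) * 2 ^ (2 * Pw * D)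
      ≡⟨ xy∙z≈xz∙y (2 ^ (Pa * W)) (y ^ (D * W)) (2 ^ (2 * Pw * D)) ⟩
    2 ^ (Pa * W) * 2 ^ (2 * Pw * D) * y ^ (D * W)
      ≡⟨ cong (_* y ^ (D * W)) (^-distribˡ-+-* 2 (Pa * W) (2 * Pw * D)) ⟨
    2 ^ (Pa * W + 2 * Pw * D) * y ^ (D * W)
      ≤⟨ *-monoˡ-≤ (y ^ (D * W)) (^-monoʳ-≤ 2 (<⇒≤ exponents)) ⟩
    2 ^ (c * (D * W) + (Na * W + 2 * Nw * D)) * y ^ (D * W)
      ≡⟨ cong (_* y ^ (D * W)) (^-distribˡ-+-* 2 (c * (D * W)) (Na * W + 2 * Nw * D)) ⟩
    2 ^ (c * (D * W)) * 2 ^ (Na * W + 2 * Nw * D) * y ^ (D * W)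
      ≡⟨ xy∙z≈xz∙y (2 ^ (c * (D * W))) (2 ^ (Na * W + 2 * Nw * D)) (y ^ (D * W)) ⟩
    2 ^ (c * (D * W)) * y ^ (D * W) * 2 ^ (Na * W + 2 * Nw * D)
      ≡⟨ cong (λ s → s * y ^ (D * W) * 2 ^ (Na * W + 2 * Nw * D)) (^-*-assoc 2 c (D * W)) ⟨
    (2 ^ c) ^ (D * W) * y ^ (D * W) * 2 ^ (Na * W + 2 * Nw * D)
      ≡⟨ cong (_* 2 ^ (Na * W + 2 * Nw * D)) (^-distribʳ-* (D * W) (2 ^ c) y) ⟨
    (2 ^ c * y) ^ (D * W) * 2 ^ (Na * W + 2 * Nw * D) ∎))
  where
  open ≤-Reasoning
  e₁ : ∀ D W → 2 * (D * W) ≡ W * (2 * D)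
  e₁ = solve-∀
  e₂ : ∀ N D → 2 * N * D ≡ N * (2 * D)
  e₂ = solve-∀

-- The lost factor is `32b`: `8b` from the count of ones and 4 from the exponent `b + 2` in place of
-- `b`. The double logarithm pays for it with `b⁴`, since `b³ ≥ 64` for `b ≥ 4`.
absorb-log-factor : ∀ {n b K x y} → 4 ≤ b → 2 ^ b * n ≤ 8 * b * K → x * (b * b) ^ 2 < 2 ^ (2 + b) * y →
                    n * x ≤ K * y
absorb-log-factor {n} {b} {K} {x} {y} 4≤b many x< = *-cancelʳ-≤ _ _ (32 * b)
  {{m*n≢0 32 b {{_}} {{>-nonZero (≤-trans (s≤s z≤n) 4≤b)}}}} (begin
  n * x * (32 * b)            ≤⟨ *-monoʳ-≤ (n * x) (begin
      32 * b              ≤⟨ *-monoˡ-≤ b (≤-trans (m≤m+n 32 32) (*-mono-≤ (*-mono-≤ 4≤b 4≤b) 4≤b)) ⟩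
      b * b * b * b       ≡⟨ fourth b ⟩
      (b * b) ^ 2         ∎) ⟩
  n * x * (b * b) ^ 2         ≡⟨ *-assoc n x ((b * b) ^ 2) ⟩
  n * (x * (b * b) ^ 2)       ≤⟨ *-monoʳ-≤ n (<⇒≤ x<) ⟩
  n * (2 ^ (2 + b) * y)       ≡⟨ regroup n (2 ^ b) y ⟩
  4 * (2 ^ b * n) * y         ≤⟨ *-monoˡ-≤ y (*-monoʳ-≤ 4 many) ⟩
  4 * (8 * b * K) * y         ≡⟨ final b K y ⟩
  K * y * (32 * b)            ∎)
  where
  open ≤-Reasoning
  fourth : ∀ b → b * b * b * b ≡ b * b * (b * b * 1)
  fourth = solve-∀
  regroup : ∀ n B y → n * (2 * (2 * B) * y) ≡ 4 * (B * n) * y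
  regroup = solve-∀
  final : ∀ b K y → 4 * (8 * b * K) * y ≡ K * y * (32 * b)
  final = solve-∀

ℕ→ℚ-*-≤ : ∀ {n x d K} → n * x ≤ K * suc d → ℕ→ℚ n ℚ.* mkℚᵘ (ℤ.+ x) d ℚ.≤ ℕ→ℚ K
ℕ→ℚ-*-≤ {n} {x} {d} {K} le = subst (λ z → mkℚᵘ z (d + 0) ℚ.≤ ℕ→ℚ K) (ℤ.pos-* n x) (frac-≤⁺
  (subst₂ _≤_ (sym (*-identityʳ (n * x))) (cong (λ d → K * suc d) (sym (+-identityʳ d))) le))

-- A point `q` of the lower cut comes with rationals `q < n * x / suc d`, `x / suc d < 2^a`,
-- `a < u - v`, `u < √(log n)`, `v > 2w` and `w > log log n`. As `u < b + 2`, it follows that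
-- `a + 2w < b + 2`, and the bounds in ℕ apply.
ones-dominate : ∀ n (p : Parameters n) → let open Parameters p in
        n · (2^ (√ (log₂ (fromNat n)) - 2 · log₂ (log₂ (fromNat n)))) ≤ᴿ
        fromNat (t * (m + (m ∸ t)) ^ b)
-- A negative lower bound for the power puts `q` below 0, hence below any count.
ones-dominate n p q (mkℚᵘ -[1+ x ] d , _ , q<) = ℚ.<-≤-trans q< (ℚ.≤-trans
  (ℚ.*-monoʳ-≤-nonNeg (ℕ→ℚ n) {mkℚᵘ -[1+ x ] d} {0ℚᵘ} (*≤* ℤ.-≤+))
  (ℕ→ℚ-*-≤ {n} {0} {0} (≤-trans (≤-reflexive (*-zeroʳ n)) z≤n)))
ones-dominate n p q (mkℚᵘ (ℤ.+ x) d ,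
  (mkℚᵘ za da , (u , v , u<√log , (mkℚᵘ zw dw , loglog<w , 2w<v) , a<u-v) , x<2^a) , q<) =
  ℚ.<-≤-trans q< (ℕ→ℚ-*-≤ {n} {x} {d} (absorb-log-factor {n} {b} {_} {x} 4≤b many (combine-powers
    {x} {suc d} {b * b} {za ⁺} {za ⁻} {zw ⁺} {zw ⁻} {2 + b} (suc da) (suc dw)
    (frac-<2^ x d za da x<2^a)
    (above-log-log {n} {b} n-lower zw dw loglog<w)
    (exponent-bound (2 + b) za da zw dw (ℚ.<-trans a<u-v
      (ℚ.+-mono-< (below-√log {n} {b} n-upper u u<√log) (ℚ.neg-mono-< 2w<v)))))))
  where open Parameters p

theorem2p1 : (∀ {α β} (M : Matrix α (suc β)) → IsCovering M →
    ∀ b m → 1 ≤ b → 1 ≤ m → A-Free b m M)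
    ×
    (∀ {α β} (M : Matrix α (suc β)) → IsCovering M →
    ∃[ C ] ∃[ n₀ ] ∀ n → n₀ ≤ n → ∃[ e ] IsEx M n e ×
    n · (2^ (√ (log₂ (fromNat n)) - C · log₂ (log₂ (fromNat n)))) ≤ᴿ fromNat e)
theorem2p1 =
  (λ { M (_ , k , cov) b m _ _ (f , g , f-mono , g-mono , entry) →
         no-embedding M k cov b m f g (λ _ _ → f-mono) g-mono entry }) ,
  -- With coefficient 2, `log log n ≥ 2 log b` yields the factor `b⁴` that `absorb-log-factor`
  -- consumes.
  λ M cov → 2 , threshold , λ n large →
    let p = choose n large
        open Parameters p
        e , isEx , many≤e = Ex-lower-bound M cov b m t n 1≤m t≤m rows≤n columns≤n
    in e , isEx , λ q q∈ → ℚ.<-≤-trans (ones-dominate n p q q∈) (frac-≤⁺ (*-monoˡ-≤ 1 many≤e))
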